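{- Let $\mathrm{Cay}(B,Y)$ be a connected Cayley graph on a finite abelian group $B$, with $Y=-Y=\{\pm y_1,\dots,\pm y_l\}\cup\{y'_1,\dots,y'_{l'}\}$ as in the context, and let $A^{0}$ and $F$ be finite abelian groups. Put $$R(Y)=\Big\{(a_1,\dots,a_{l+l'})\in\mathbb{Z}^{l+l'}:\ \sum_{i=1}^{l}a_iy_i+\sum_{j=1}^{l'}a_{l+j}y'_j=0\Big\},$$ $$R_0=\{(a_1,\dots,a_{l+l'})\in\mathbb{Z}^{l+l'}:\ a_1=\cdots=a_l=0,\ 2\mid a_{l+j}\text{ for }1\le j\le l'\},$$ $$R=\{(a_1,\dots,a_{l+l'})\in\mathbb{Z}^{l+l'}:\ \exp(B)\exp(F)\mid a_i\text{ for }1\le i\le l+l'\},$$ and $\overline{R(Y)}=R(Y)/R$, $\overline{R_0}=(R_0+R)/R$, both subgroups of $\mathbb{Z}^{l+l'}/R$. Then the isomorphism classes of typical abelian coverings $\mathrm{Cay}(A,X)\to\mathrm{Cay}(B,Y)$ such that $A\cong A^{0}$ and the covering transformation group is isomorphic to $F$ are in one-to-one correspondence with the subgroups $D$ of $\overline{R(Y)}$ such that $\overline{R_0}\leqslant D$, $(\mathbb{Z}^{l+l'}/R)/D\cong A^{0}$ and $\overline{R(Y)}/D\cong F$.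
   Context: All graphs are finite, simple and connected; all groups are abelian, written additively. For a finite abelian group $A$ and a subset $X\subseteq A$ with $X=-X$ and $0\notin X$, the Cayley graph $\mathrm{Cay}(A,X)$ has vertex set $A$ and edge set $\{\{g,g+x\}: g\in A,\ x\in X\}$; it is connected iff $X$ generates $A$. A covering of graphs $p:\tilde G\to G$ is a surjection $p:V(\tilde G)\to V(G)$ such that $p|_{N(\tilde v)}:N(\tilde v)\to N(v)$ is bijective for all $v\in V(G)$ and $\tilde v\in p^{ -1}(v)$, where $N(\cdot)$ denotes the set of adjacent vertices. Two coverings $p_i:\tilde G_i\to G$ ($i=1,2$) are isomorphic if there is a graph isomorphism $\Phi:\tilde G_1\to\tilde G_2$ with $p_2\circ\Phi=p_1$. A typical (abelian) covering $\mathrm{Cay}(A,X)\to\mathrm{Cay}(B,Y)$ is a covering induced by a surjective homomorphism $f:A\to B$ of finite abelian groups with $f(X)=Y$; it is always assumed that $X\cap\ker f=\emptyset$ and that $f|_X:X\to Y$ is bijective. Its covering transformation group is $\ker f$. Standing notation: $Y=-Y$, $0\notin Y$, $\langle Y\rangle=B$, and $Y=\{\pm y_1,\dots,\pm y_l\}\cup\{y'_1,\dots,y'_{l'}\}$ with $2y_i\neq0$ for $1\le i\le l$ and $2y'_j=0$ for $1\le j\le l'$, the $2l+l'$ listed elements being distinct (so the graph has valence $2l+l'$). $\exp(A)$ is the exponent of $A$, the least positive integer $s$ with $sa=0$ for all $a\in A$. -}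

module Defs where

open import Level using (0ℓ) renaming (suc to lsuc)
open import Algebra.Bundles using (AbelianGroup)
open import Algebra.Structures using (IsAbelianGroup)
open import Algebra.Morphism.Structures using (module GroupMorphisms)
import Algebra.Construct.Pointwise as Pointwise
import Algebra.Properties.AbelianGroup as AbelianGroupProperties
import Algebra.Properties.CommutativeMonoid.Mult as Mult
import Algebra.Properties.CommutativeMonoid.Sum as Sum
open import Data.Empty using (⊥-elim)
open import Data.Fin as Fin using (Fin; toℕ; _↑ˡ_; _↑ʳ_)
import Data.Fin.Properties as Fin
open import Data.Integer as ℤ using (ℤ; +_; -[1+_])
open import Data.Integer.Divisibility.Signed using (_∣_; divides; ∣m∣n⇒∣m+n; ∣m⇒∣-m)
import Data.Integer.Properties as ℤ
open import Data.Nat as ℕ using (ℕ; zero; suc; _≤_; _<_; _∸_; s≤s; z≤n; _!)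
import Data.Nat.Divisibility as ℕ
import Data.Nat.Properties as ℕ
open import Data.Product using (Σ; ∃; ∃-syntax; _×_; _,_; proj₁; proj₂; map₂)
open import Data.Sum using (_⊎_; inj₁; inj₂; [_,_])
open import Data.Vec.Functional using (Vector)
open import Function using (_∘_; _⇔_; mk⇔; Inverse; Equivalence; Injective; StrictlySurjective)
import Function.Construct.Composition as Compose
import Function.Construct.Identity as Identity
import Function.Construct.Symmetry as Symmetry
open import Relation.Binary using (Rel; Setoid; IsEquivalence; Symmetric; Irreflexive; _Respects_; _Respects₂_)
open import Relation.Binary.Construct.Closure.ReflexiveTransitive using (Star; _◅_; _◅◅_) renaming (ε to done)
open import Relation.Binary.PropositionalEquality as ≡ using (_≡_)
import Relation.Binary.Reasoning.Setoid as SetoidReasoning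
open import Relation.Nullary using (¬_; Dec; yes; no)
import Relation.Nullary.Decidable as Dec
open import Relation.Unary using (Pred; _⊆_; _≐_; Decidable)

Finite : Setoid 0ℓ 0ℓ → Set
Finite S = ∃[ n ] Inverse S (≡.setoid (Fin n))

module _ (S T : Setoid 0ℓ 0ℓ) where
  private
    module S = Setoid S
    module T = Setoid T

  record BijectiveOn (f : S.Carrier → T.Carrier)
                     (P : Pred S.Carrier 0ℓ) (Q : Pred T.Carrier 0ℓ) : Set where
    field
      maps       : ∀ {x} → P x → Q (f x)
      injective  : ∀ {x x′} → P x → P x′ → f x T.≈ f x′ → x S.≈ x′
      surjective : ∀ {y} → Q y → ∃[ x ] (P x × f x T.≈ y)

-- Vertices form a setoid, so paths are followed up to _≈_.
record Graph : Set (lsuc 0ℓ) where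
  field
    V           : Setoid 0ℓ 0ℓ
  open Setoid V public
  field
    Adj         : Rel Carrier 0ℓ
    Adj-resp-≈  : Adj Respects₂ _≈_
    Adj-sym     : Symmetric Adj
    Adj-irrefl  : Irreflexive _≈_ Adj
    finite      : Finite V
    connected   : ∀ u v → ∃[ w ] (Star Adj u w × w ≈ v)

record Covering (G̃ G : Graph) : Set where
  private
    module G̃ = Graph G̃
    module G = Graph G
  field
    p          : G̃.Carrier → G.Carrier
    cong       : ∀ {u v} → u G̃.≈ v → p u G.≈ p v
    surjective : StrictlySurjective G._≈_ p
    local      : ∀ v ṽ → p ṽ G.≈ v → BijectiveOn G̃.V G.V p (G̃.Adj ṽ) (G.Adj v)

record GraphIsomorphism (G H : Graph) : Set where
  private
    module G = Graph G
    module H = Graph H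
  field
    bijection : Inverse G.V H.V
  open Inverse bijection public using (to; from)
  field
    adjacency : ∀ u v → G.Adj u v ⇔ H.Adj (to u) (to v)

IsomorphicCoverings : {G₁ G₂ G : Graph} → Covering G₁ G → Covering G₂ G → Set
IsomorphicCoverings {G₁} {G₂} {G} p₁ p₂ =
  Σ (GraphIsomorphism G₁ G₂) λ Φ →
    ∀ v → Covering.p p₂ (GraphIsomorphism.to Φ v) ≈ Covering.p p₁ v
  where open Graph G using (_≈_)

module _ {G : Graph} where
  private module G = Graph G

  IsomorphicCoverings-refl : ∀ {G₁} (p : Covering G₁ G) → IsomorphicCoverings p p
  IsomorphicCoverings-refl p =
    record { bijection = Identity.inverse _ ; adjacency = λ _ _ → mk⇔ (λ e → e) (λ e → e) } ,
    λ _ → G.refl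

  IsomorphicCoverings-sym : ∀ {G₁ G₂} {p₁ : Covering G₁ G} {p₂ : Covering G₂ G} →
    IsomorphicCoverings p₁ p₂ → IsomorphicCoverings p₂ p₁
  IsomorphicCoverings-sym {G₁} {G₂} {p₁} {p₂} (Φ , comm) =
    record { bijection = Symmetry.inverse bijection ; adjacency = adj } ,
    λ v → G.trans (G.sym (comm (from v))) (Covering.cong p₂ (Φ.strictlyInverseˡ v))
    where
    open GraphIsomorphism Φ
    module Φ = Inverse bijection
    module G₂ = Graph G₂
    adj : ∀ u v → G₂.Adj u v ⇔ Graph.Adj G₁ (from u) (from v)
    adj u v = mk⇔
      (λ e → Equivalence.from (adjacency (from u) (from v))
        (proj₁ G₂.Adj-resp-≈ (G₂.sym (Φ.strictlyInverseˡ v))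
          (proj₂ G₂.Adj-resp-≈ (G₂.sym (Φ.strictlyInverseˡ u)) e)))
      (λ e → proj₁ G₂.Adj-resp-≈ (Φ.strictlyInverseˡ v)
        (proj₂ G₂.Adj-resp-≈ (Φ.strictlyInverseˡ u)
          (Equivalence.to (adjacency (from u) (from v)) e)))

  IsomorphicCoverings-trans : ∀ {G₁ G₂ G₃}
    {p₁ : Covering G₁ G} {p₂ : Covering G₂ G} {p₃ : Covering G₃ G} →
    IsomorphicCoverings p₁ p₂ → IsomorphicCoverings p₂ p₃ → IsomorphicCoverings p₁ p₃
  IsomorphicCoverings-trans (Φ , comm) (Ψ , comm′) =
    record
      { bijection = Compose.inverse (bijection Φ) (bijection Ψ)
      ; adjacency = λ u v → Compose.equivalence (adjacency Φ u v) (adjacency Ψ (to Φ u) (to Φ v))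
      } ,
    λ v → G.trans (comm′ (to Φ v)) (comm v)
    where open GraphIsomorphism

-- Abelian groups.  The library writes the operation as _∙_, the neutral
-- element as ε and inverses as _⁻¹; these are +, 0 and - here.

AbGroup : Set (lsuc 0ℓ)
AbGroup = AbelianGroup 0ℓ 0ℓ

IsHomomorphism : (A B : AbGroup) → (AbelianGroup.Carrier A → AbelianGroup.Carrier B) → Set
IsHomomorphism A B = GroupMorphisms.IsGroupHomomorphism (AbelianGroup.rawGroup A) (AbelianGroup.rawGroup B)

infix 4 _≅_

_≅_ : AbGroup → AbGroup → Set
A ≅ B = Σ (AbelianGroup.Carrier A → AbelianGroup.Carrier B)
  (GroupMorphisms.IsGroupIsomorphism (AbelianGroup.rawGroup A) (AbelianGroup.rawGroup B))

record FiniteAbelianGroup : Set (lsuc 0ℓ) where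
  field
    abelianGroup : AbGroup
  open AbelianGroup abelianGroup public
  field
    finite       : Finite setoid

mkHomomorphism : (A B : AbGroup) (f : AbelianGroup.Carrier A → AbelianGroup.Carrier B) →
  (∀ {x y} → AbelianGroup._≈_ A x y → AbelianGroup._≈_ B (f x) (f y)) →
  (∀ x y → AbelianGroup._≈_ B (f (AbelianGroup._∙_ A x y)) (AbelianGroup._∙_ B (f x) (f y))) →
  IsHomomorphism A B f
mkHomomorphism A B f f-cong f-∙ = record
  { isMonoidHomomorphism = record
    { isMagmaHomomorphism = record
      { isRelHomomorphism = record { cong = f-cong }
      ; homo = f-∙
      }
    ; ε-homo = f-ε
    }
  ; ⁻¹-homo = λ x → P.inverseˡ-unique _ _
      (B.trans (B.sym (f-∙ _ _)) (B.trans (f-cong (A.inverseˡ x)) f-ε))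
  }
  where
  module A = AbelianGroup A
  module B = AbelianGroup B
  module P = AbelianGroupProperties B
  f-ε : f A.ε B.≈ B.ε
  f-ε = P.identityˡ-unique _ _ (B.trans (B.sym (f-∙ _ _)) (f-cong (A.identityˡ A.ε)))

record Subgroup (G : AbGroup) : Set (lsuc 0ℓ) where
  open AbelianGroup G
  field
    Member    : Pred Carrier 0ℓ
    resp      : Member Respects _≈_
    ε-closed  : Member ε
    ∙-closed  : ∀ {x y} → Member x → Member y → Member (x ∙ y)
    ⁻¹-closed : ∀ {x} → Member x → Member (x ⁻¹)

open Subgroup public using (Member)

infix 4 _⩽_

_⩽_ : {G : AbGroup} → Subgroup G → Subgroup G → Set
H ⩽ K = Member H ⊆ Member K

asGroup : {G : AbGroup} → Subgroup G → AbGroup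
asGroup {G} H = record
  { Carrier = Σ Carrier (Member H)
  ; _≈_ = λ x y → proj₁ x ≈ proj₁ y
  ; _∙_ = λ x y → proj₁ x ∙ proj₁ y , ∙-closed (proj₂ x) (proj₂ y)
  ; ε = ε , ε-closed
  ; _⁻¹ = λ x → proj₁ x ⁻¹ , ⁻¹-closed (proj₂ x)
  ; isAbelianGroup = record
    { isGroup = record
      { isMonoid = record
        { isSemigroup = record
          { isMagma = record
            { isEquivalence = record { refl = refl ; sym = sym ; trans = trans }
            ; ∙-cong = ∙-cong
            }
          ; assoc = λ _ _ _ → assoc _ _ _
          }
        ; identity = (λ _ → identityˡ _) , (λ _ → identityʳ _)
        }
      ; inverse = (λ _ → inverseˡ _) , (λ _ → inverseʳ _)
      ; ⁻¹-cong = ⁻¹-cong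
      }
    ; comm = λ _ _ → comm _ _
    }
  }
  where
  open AbelianGroup G
  open Subgroup H hiding (Member)

-- H ∩ K as a subgroup of K; it is H itself when H ⩽ K.
restrict : {G : AbGroup} (H K : Subgroup G) → Subgroup (asGroup K)
restrict H K = record
  { Member    = λ x → Member H (proj₁ x)
  ; resp      = resp
  ; ε-closed  = ε-closed
  ; ∙-closed  = ∙-closed
  ; ⁻¹-closed = ⁻¹-closed
  }
  where open Subgroup H hiding (Member)

infixl 7 _/_

-- G / H has the elements of G as representatives, equal when they differ
-- by an element of H.
_/_ : (G : AbGroup) → Subgroup G → AbGroup
G / H = record
  { Carrier = Carrier
  ; _≈_ = λ x y → Member H (x - y)
  ; _∙_ = _∙_
  ; ε = ε
  ; _⁻¹ = _⁻¹
  ; isAbelianGroup = record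
    { isGroup = record
      { isMonoid = record
        { isSemigroup = record
          { isMagma = record
            { isEquivalence = record
              { refl  = ≈⇒ refl
              ; sym   = λ {x} {y} h → resp (⁻¹-anti-homo‿- x y) (⁻¹-closed h)
              ; trans = λ {x} {y} {z} h k → resp (telescope x y z) (∙-closed h k)
              }
            ; ∙-cong = λ {x} {y} {u} {v} h k → resp (interchange x y u v) (∙-closed h k)
            }
          ; assoc = λ x y z → ≈⇒ (assoc x y z)
          }
        ; identity = (λ x → ≈⇒ (identityˡ x)) , (λ x → ≈⇒ (identityʳ x))
        }
      ; inverse = (λ x → ≈⇒ (inverseˡ x)) , (λ x → ≈⇒ (inverseʳ x))
      ; ⁻¹-cong = λ {x} {y} h → resp (sym (⁻¹-∙-comm x (y ⁻¹))) (⁻¹-closed h)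
      }
    ; comm = λ x y → ≈⇒ (comm x y)
    }
  }
  where
  open AbelianGroup G
  open AbelianGroupProperties G
  open Subgroup H hiding (Member)
  open SetoidReasoning setoid
  ≈⇒ : ∀ {x y} → x ≈ y → Member H (x - y)
  ≈⇒ e = resp (sym (x≈y⇒x∙y⁻¹≈ε e)) ε-closed
  telescope : ∀ x y z → (x - y) ∙ (y - z) ≈ x - z
  telescope x y z = begin
    (x ∙ y ⁻¹) ∙ (y ∙ z ⁻¹)  ≈⟨ assoc _ _ _ ⟨
    x ∙ y ⁻¹ ∙ y ∙ z ⁻¹      ≈⟨ ∙-congʳ (//-rightDividesˡ y x) ⟩
    x ∙ z ⁻¹                 ∎
  interchange : ∀ x y u v → (x - y) ∙ (u - v) ≈ (x ∙ u) - (y ∙ v)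
  interchange x y u v = begin
    (x ∙ y ⁻¹) ∙ (u ∙ v ⁻¹)  ≈⟨ assoc _ _ _ ⟩
    x ∙ (y ⁻¹ ∙ (u ∙ v ⁻¹))  ≈⟨ ∙-congˡ (assoc _ _ _) ⟨
    x ∙ (y ⁻¹ ∙ u ∙ v ⁻¹)    ≈⟨ ∙-congˡ (∙-congʳ (comm _ _)) ⟩
    x ∙ (u ∙ y ⁻¹ ∙ v ⁻¹)    ≈⟨ ∙-congˡ (assoc _ _ _) ⟩
    x ∙ (u ∙ (y ⁻¹ ∙ v ⁻¹))  ≈⟨ assoc _ _ _ ⟨
    x ∙ u ∙ (y ⁻¹ ∙ v ⁻¹)    ≈⟨ ∙-congˡ (⁻¹-∙-comm y v) ⟩
    x ∙ u ∙ (y ∙ v) ⁻¹       ∎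

infixl 6 _mod_

-- The image of H in G / N, that is (H + N) / N; it is H / N when N ⩽ H.
_mod_ : {G : AbGroup} → Subgroup G → (N : Subgroup G) → Subgroup (G / N)
_mod_ {G} H N = record
  { Member    = λ x → ∃[ h ] (Member H h × h Q.≈ x)
  ; resp      = λ e (h , h∈H , h≈x) → h , h∈H , Q.trans h≈x e
  ; ε-closed  = ε , ε-closed , Q.refl
  ; ∙-closed  = λ (h , h∈H , h≈x) (k , k∈H , k≈y) → h ∙ k , ∙-closed h∈H k∈H , Q.∙-cong h≈x k≈y
  ; ⁻¹-closed = λ (h , h∈H , h≈x) → h ⁻¹ , ⁻¹-closed h∈H , Q.⁻¹-cong h≈x
  }
  where
  open AbelianGroup G using (ε; _∙_; _⁻¹)
  module Q = AbelianGroup (G / N)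
  open Subgroup H hiding (Member)

Ker : {A B : AbGroup} (f : AbelianGroup.Carrier A → AbelianGroup.Carrier B) →
      IsHomomorphism A B f → Subgroup A
Ker {A} {B} f isHom = record
  { Member    = λ a → f a ≈ ε
  ; resp      = λ e fa≈ε → trans (⟦⟧-cong (A.sym e)) fa≈ε
  ; ε-closed  = ε-homo
  ; ∙-closed  = λ p q → trans (homo _ _) (trans (∙-cong p q) (identityˡ ε))
  ; ⁻¹-closed = λ p → trans (⁻¹-homo _) (trans (⁻¹-cong p) ε⁻¹≈ε)
  }
  where
  module A = AbelianGroup A
  open AbelianGroup B
  open AbelianGroupProperties B using (ε⁻¹≈ε)
  open GroupMorphisms.IsGroupHomomorphism isHom
    using (ε-homo; homo; ⁻¹-homo; ⟦⟧-cong)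

data ⟨_⟩ {G : AbGroup} (X : Pred (AbelianGroup.Carrier G) 0ℓ) : Pred (AbelianGroup.Carrier G) 0ℓ where
  gen  : ∀ {x} → X x → ⟨_⟩ {G} X x
  ≈-cl : ∀ {x y} → AbelianGroup._≈_ G x y → ⟨_⟩ {G} X x → ⟨_⟩ {G} X y
  ε-cl : ⟨_⟩ {G} X (AbelianGroup.ε G)
  ∙-cl : ∀ {x y} → ⟨_⟩ {G} X x → ⟨_⟩ {G} X y → ⟨_⟩ {G} X (AbelianGroup._∙_ G x y)
  ⁻-cl : ∀ {x} → ⟨_⟩ {G} X x → ⟨_⟩ {G} X (AbelianGroup._⁻¹ G x)

module _ (A : FiniteAbelianGroup) where
  open FiniteAbelianGroup A
  open Mult commutativeMonoid renaming (_×_ to _·_)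
  open AbelianGroupProperties abelianGroup

  Annihilates : Pred ℕ 0ℓ
  Annihilates s = 0 < s × (∀ a → s · a ≈ ε)

  IsExponent : Pred ℕ 0ℓ
  IsExponent s = Annihilates s × (∀ t → Annihilates t → s ≤ t)

  private
    n : ℕ
    n = proj₁ finite
    module I = Inverse (proj₂ finite)

    _≟_ : ∀ a b → Dec (a ≈ b)
    a ≟ b = Dec.map′
      (λ e → trans (sym (I.strictlyInverseʳ a)) (trans (I.from-cong e) (I.strictlyInverseʳ b)))
      I.to-cong
      (I.to a Fin.≟ I.to b)

    annihilates? : Decidable Annihilates
    annihilates? s = (0 ℕ.<? s) Dec.×-dec Dec.map′
      (λ h a → trans (×-congʳ s (sym (I.strictlyInverseʳ a))) (h (I.to a)))
      (λ h i → h (I.from i))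
      (Fin.all? λ i → (s · I.from i) ≟ ε)

    order : ∀ a → ∃[ d ] (0 < d × d ≤ n × d · a ≈ ε)
    order a with Fin.pigeonhole (ℕ.n<1+n n) (λ i → I.to (toℕ i · a))
    ... | i , j , i<j , eq =
      toℕ j ∸ toℕ i , ℕ.m<n⇒0<n∸m i<j ,
      ℕ.≤-trans (ℕ.m∸n≤m (toℕ j) (toℕ i)) (Fin.toℕ≤pred[n] j) ,
      identityʳ-unique (toℕ i · a) _ (begin
        toℕ i · a ∙ (toℕ j ∸ toℕ i) · a  ≈⟨ ×-homo-+ a (toℕ i) _ ⟨
        (toℕ i ℕ.+ (toℕ j ∸ toℕ i)) · a  ≡⟨ ≡.cong (_· a) (ℕ.m+[n∸m]≡n (ℕ.<⇒≤ i<j)) ⟩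
        toℕ j · a                        ≈⟨ I.strictlyInverseʳ _ ⟨
        I.from (I.to (toℕ j · a))        ≡⟨ ≡.cong I.from eq ⟨
        I.from (I.to (toℕ i · a))        ≈⟨ I.strictlyInverseʳ _ ⟩
        toℕ i · a                        ∎)
      where open SetoidReasoning setoid

    ×-zero : ∀ m → m · ε ≈ ε
    ×-zero zero    = refl
    ×-zero (suc m) = trans (identityˡ _) (×-zero m)

    n!-annihilates : Annihilates (n !)
    n!-annihilates = ℕ.1≤n! n , kills
      where
      kills : ∀ a → (n !) · a ≈ ε
      kills a with order a
      ... | suc d , _ , d≤n , eq
        with ℕ.divides q n!≡ ← ℕ.∣-trans (ℕ.m∣m*n {suc d} (d !)) (ℕ.m≤n⇒m!∣n! d≤n) = begin
          (n !) · a            ≡⟨ ≡.cong (_· a) n!≡ ⟩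
          (q ℕ.* suc d) · a    ≈⟨ ×-assocˡ a q (suc d) ⟨
          q · (suc d · a)      ≈⟨ ×-congʳ q eq ⟩
          q · ε                ≈⟨ ×-zero q ⟩
          ε                    ∎
        where open SetoidReasoning setoid

    least : {P : Pred ℕ 0ℓ} → Decidable P → ∀ m → P m → ∃[ s ] (P s × (∀ t → P t → s ≤ t))
    least P? zero    pm = zero , pm , λ _ _ → z≤n
    least P? (suc m) pm with P? 0
    ... | yes p0 = zero , p0 , λ _ _ → z≤n
    ... | no ¬p0 with least (P? ∘ suc) m pm
    ...   | s , ps , s-min = suc s , ps ,
            λ { zero p0 → ⊥-elim (¬p0 p0) ; (suc t) pt → s≤s (s-min t pt) }

  exponent : ∃ IsExponent
  exponent = least annihilates? (n !) n!-annihilates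

  exp : ℕ
  exp = proj₁ exponent

-- Elem is a subset X with X = -X, 0 ∉ X and ⟨X⟩ = A.
record ConnectionSet (A : FiniteAbelianGroup) : Set (lsuc 0ℓ) where
  open FiniteAbelianGroup A
  field
    Elem      : Pred Carrier 0ℓ
    resp      : Elem Respects _≈_
    symmetric : ∀ {x} → Elem x → Elem (x ⁻¹)
    0∉        : ¬ Elem ε
    generates : ∀ a → ⟨_⟩ {abelianGroup} Elem a

open ConnectionSet public using (Elem)

-- The edge {g , g + x} may be read from either end because X = -X.
Cay : (A : FiniteAbelianGroup) → ConnectionSet A → Graph
Cay A X = record
  { V          = setoid
  ; Adj        = Adj
  ; Adj-resp-≈ = (λ e (x , x∈X , h≈) → x , x∈X , trans (sym e) h≈) ,
                 (λ e (x , x∈X , h≈) → x , x∈X , trans h≈ (∙-congʳ e))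
  ; Adj-sym    = λ {g} {h} (x , x∈X , h≈) → x ⁻¹ , symmetric x∈X ,
                 trans (sym (//-rightDividesʳ x g)) (∙-congʳ (sym h≈))
  ; Adj-irrefl = λ {g} {h} g≈h (x , x∈X , h≈) →
                 0∉ (CX.resp (identityʳ-unique g x (trans (sym h≈) (sym g≈h))) x∈X)
  ; finite     = finite
  ; connected  = λ u v →
      let (w , path , w≈) = walk (generates (u ⁻¹ ∙ v)) u
      in w , path , trans w≈ (\\-leftDividesˡ u v)
  }
  where
  open FiniteAbelianGroup A
  open AbelianGroupProperties abelianGroup
  module CX = ConnectionSet X
  open CX using (symmetric; 0∉; generates)
  Adj : Rel Carrier 0ℓ
  Adj g h = ∃[ x ] (Elem X x × h ≈ g ∙ x)

  walk : ∀ {a} → ⟨_⟩ {abelianGroup} (Elem X) a →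
         ∀ u → ∃[ w ] (Star Adj u w × w ≈ u ∙ a)
  walk⁻¹ : ∀ {a} → ⟨_⟩ {abelianGroup} (Elem X) a →
           ∀ u → ∃[ w ] (Star Adj u w × w ≈ u ∙ a ⁻¹)
  walk (gen x∈X) u = _ , (_ , x∈X , refl) ◅ done , refl
  walk (≈-cl e p) u = map₂ (map₂ λ w≈ → trans w≈ (∙-congˡ e)) (walk p u)
  walk ε-cl u = u , done , sym (identityʳ u)
  walk (∙-cl p q) u with walk p u
  ... | w , path , w≈ with walk q w
  ...   | w′ , path′ , w′≈ = w′ , path ◅◅ path′ , trans w′≈ (trans (∙-congʳ w≈) (assoc _ _ _))
  walk (⁻-cl p) u = walk⁻¹ p u
  walk⁻¹ (gen x∈X) u = _ , (_ , symmetric x∈X , refl) ◅ done , refl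
  walk⁻¹ (≈-cl e p) u = map₂ (map₂ λ w≈ → trans w≈ (∙-congˡ (⁻¹-cong e))) (walk⁻¹ p u)
  walk⁻¹ ε-cl u = u , done , sym (trans (∙-congˡ ε⁻¹≈ε) (identityʳ u))
  walk⁻¹ (∙-cl p q) u with walk⁻¹ p u
  ... | w , path , w≈ with walk⁻¹ q w
  ...   | w′ , path′ , w′≈ = w′ , path ◅◅ path′ ,
          trans w′≈ (trans (∙-congʳ w≈) (trans (assoc _ _ _) (∙-congˡ (⁻¹-∙-comm _ _))))
  walk⁻¹ (⁻-cl p) u = map₂ (map₂ λ w≈ → trans w≈ (∙-congˡ (sym (⁻¹-involutive _)))) (walk p u)

record TypicalCovering (B : FiniteAbelianGroup) (Y : ConnectionSet B) : Set (lsuc 0ℓ) where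
  private module B = FiniteAbelianGroup B
  field
    A              : FiniteAbelianGroup
    X              : ConnectionSet A
  private module A = FiniteAbelianGroup A
  field
    f              : A.Carrier → B.Carrier
    isHomomorphism : IsHomomorphism A.abelianGroup B.abelianGroup f
    surjective     : StrictlySurjective B._≈_ f
    image          : (λ b → ∃[ x ] (Elem X x × f x B.≈ b)) ≐ Elem Y
    X∩ker          : ∀ {x} → Elem X x → ¬ (f x B.≈ B.ε)
    bijective      : BijectiveOn A.setoid B.setoid f (Elem X) (Elem Y)

  kernel : Subgroup A.abelianGroup
  kernel = Ker {B = B.abelianGroup} f isHomomorphism

  covering : Covering (Cay A X) (Cay B Y)
  covering = record
    { p          = f
    ; cong       = ⟦⟧-cong
    ; surjective = surjective
    ; local      = λ v ṽ fṽ≈v → record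
      { maps       = λ (x , x∈X , u≈) → f x , BijectiveOn.maps bijective x∈X ,
                     B.trans (⟦⟧-cong u≈) (B.trans (homo _ _) (B.∙-congʳ fṽ≈v))
      ; injective  = λ {u} {u′} (x , x∈X , u≈) (x′ , x′∈X , u′≈) fu≈fu′ →
          A.trans u≈ (A.trans
            (A.∙-congˡ (BijectiveOn.injective bijective x∈X x′∈X
              (∙-cancelˡ (f ṽ) _ _
                (B.trans (B.sym (homo ṽ x)) (B.trans (⟦⟧-cong (A.sym u≈))
                  (B.trans fu≈fu′ (B.trans (⟦⟧-cong u′≈) (homo ṽ x′))))))))
            (A.sym u′≈))
      ; surjective = λ {w} (y , y∈Y , w≈) →
          let (x , x∈X , fx≈y) = BijectiveOn.surjective bijective y∈Y
          in ṽ A.∙ x , (x , x∈X , A.refl) ,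
             B.trans (homo _ _) (B.trans (B.∙-cong fṽ≈v fx≈y) (B.sym w≈))
      }
    }
    where
    open GroupMorphisms.IsGroupHomomorphism isHomomorphism
    open AbelianGroupProperties B.abelianGroup using (∙-cancelˡ)

-- Isomorphism classes of typical coverings of Cay(B,Y) with A ≅ A⁰ and
-- covering transformation group isomorphic to F: the classes are the
-- elements of this setoid.
CoveringClasses : (B : FiniteAbelianGroup) → ConnectionSet B → (A⁰ F : FiniteAbelianGroup) →
                  Setoid (lsuc 0ℓ) 0ℓ
CoveringClasses B Y A⁰ F = record
  { Carrier = Σ (TypicalCovering B Y) λ c →
      abelianGroup (TypicalCovering.A c) ≅ abelianGroup A⁰ ×
      asGroup (TypicalCovering.kernel c) ≅ abelianGroup F
  ; _≈_ = λ c d → IsomorphicCoverings (covering (proj₁ c)) (covering (proj₁ d))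
  ; isEquivalence = record
    { refl  = λ {c} → IsomorphicCoverings-refl (covering (proj₁ c))
    ; sym   = λ {c} {d} → IsomorphicCoverings-sym
                {p₁ = covering (proj₁ c)} {p₂ = covering (proj₁ d)}
    ; trans = λ {c} {d} {e} → IsomorphicCoverings-trans
                {p₁ = covering (proj₁ c)} {p₂ = covering (proj₁ d)} {p₃ = covering (proj₁ e)}
    }
  }
  where
  open FiniteAbelianGroup using (abelianGroup)
  open TypicalCovering using (covering)

-- Y = {± y₁, …, ± yₗ} ∪ {y′₁, …, y′ₗ′}, the 2l + l′ listed elements being
-- distinct (so that listed is injective).
record Listing {B : FiniteAbelianGroup} (Y : ConnectionSet B) (l l′ : ℕ) : Set where
  open FiniteAbelianGroup B
  field
    y    : Vector Carrier l
    y′   : Vector Carrier l′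

  listed : Fin l ⊎ Fin l ⊎ Fin l′ → Carrier
  listed = [ y , [ (λ i → y i ⁻¹) , y′ ] ]

  field
    2y≉0     : ∀ i → ¬ (y i ∙ y i ≈ ε)
    2y′≈0    : ∀ j → y′ j ∙ y′ j ≈ ε
    distinct : Injective _≡_ _≈_ listed
    lists    : Elem Y ≐ (λ b → ∃[ k ] b ≈ listed k)

ℤ^ : ℕ → AbGroup
ℤ^ n = Pointwise.abelianGroup (Fin n) ℤ.+-0-abelianGroup

module IntegerMultiples (B : AbGroup) where
  open AbelianGroup B
  open AbelianGroupProperties B
  open Mult commutativeMonoid using (×-homo-+) renaming (_×_ to _ℕ·_)
  open SetoidReasoning setoid

  infixr 8 _·_

  _·_ : ℤ → Carrier → Carrier
  (+ n)    · b = n ℕ· b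
  -[1+ n ] · b = (suc n ℕ· b) ⁻¹

  private
    cancel : ∀ b x y → (b ∙ x) - (b ∙ y) ≈ x - y
    cancel b x y = begin
      (b ∙ x) ∙ (b ∙ y) ⁻¹      ≈⟨ ∙-cong (comm b x) (⁻¹-anti-homo-∙ b y) ⟩
      (x ∙ b) ∙ (y ⁻¹ ∙ b ⁻¹)   ≈⟨ ∙-congˡ (comm _ _) ⟩
      (x ∙ b) ∙ (b ⁻¹ ∙ y ⁻¹)   ≈⟨ assoc _ _ _ ⟨
      x ∙ b ∙ b ⁻¹ ∙ y ⁻¹       ≈⟨ ∙-congʳ (//-rightDividesʳ b x) ⟩
      x ∙ y ⁻¹                  ∎

    ⊖-homo : ∀ m n b → (m ℤ.⊖ n) · b ≈ (m ℕ· b) - (n ℕ· b)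
    ⊖-homo zero    zero    b = sym (trans (identityˡ _) ε⁻¹≈ε)
    ⊖-homo zero    (suc n) b = sym (identityˡ _)
    ⊖-homo (suc m) zero    b = sym (trans (∙-congˡ ε⁻¹≈ε) (identityʳ _))
    ⊖-homo (suc m) (suc n) b = begin
      (suc m ℤ.⊖ suc n) · b        ≡⟨ ≡.cong (_· b) (ℤ.[1+m]⊖[1+n]≡m⊖n m n) ⟩
      (m ℤ.⊖ n) · b                ≈⟨ ⊖-homo m n b ⟩
      (m ℕ· b) - (n ℕ· b)          ≈⟨ cancel b _ _ ⟨
      (suc m ℕ· b) - (suc n ℕ· b)  ∎

  ·-homo-+ : ∀ a a′ b → (a ℤ.+ a′) · b ≈ a · b ∙ a′ · b
  ·-homo-+ (+ m)    (+ n)    b = ×-homo-+ b m n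
  ·-homo-+ (+ m)    -[1+ n ] b = ⊖-homo m (suc n) b
  ·-homo-+ -[1+ m ] (+ n)    b = trans (⊖-homo n (suc m) b) (comm _ _)
  ·-homo-+ -[1+ m ] -[1+ n ] b = begin
    (suc (suc (m ℕ.+ n)) ℕ· b) ⁻¹        ≡⟨ ≡.cong (λ k → (suc k ℕ· b) ⁻¹) (ℕ.+-suc m n) ⟨
    ((suc m ℕ.+ suc n) ℕ· b) ⁻¹          ≈⟨ ⁻¹-cong (×-homo-+ b (suc m) (suc n)) ⟩
    ((suc m ℕ· b) ∙ (suc n ℕ· b)) ⁻¹     ≈⟨ ⁻¹-∙-comm _ _ ⟨
    (suc m ℕ· b) ⁻¹ ∙ (suc n ℕ· b) ⁻¹    ∎

module _ {B : FiniteAbelianGroup} {Y : ConnectionSet B} {l l′ : ℕ} (L : Listing Y l l′) where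
  open FiniteAbelianGroup B
  open Listing L
  open IntegerMultiples abelianGroup
  open Sum commutativeMonoid
  open SetoidReasoning setoid

  evaluate : Vector ℤ (l ℕ.+ l′) → Carrier
  evaluate a = sum (λ i → a (i ↑ˡ l′) · y i) ∙ sum (λ j → a (l ↑ʳ j) · y′ j)

  private
    interchange : ∀ p q r s → (p ∙ q) ∙ (r ∙ s) ≈ (p ∙ r) ∙ (q ∙ s)
    interchange p q r s = begin
      (p ∙ q) ∙ (r ∙ s)  ≈⟨ assoc _ _ _ ⟩
      p ∙ (q ∙ (r ∙ s))  ≈⟨ ∙-congˡ (assoc _ _ _) ⟨
      p ∙ (q ∙ r ∙ s)    ≈⟨ ∙-congˡ (∙-congʳ (comm _ _)) ⟩
      p ∙ (r ∙ q ∙ s)    ≈⟨ ∙-congˡ (assoc _ _ _) ⟩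
      p ∙ (r ∙ (q ∙ s))  ≈⟨ assoc _ _ _ ⟨
      (p ∙ r) ∙ (q ∙ s)  ∎

    sum-homo : ∀ {n} (a b : Vector ℤ n) (v : Vector Carrier n) →
      sum (λ i → (a i ℤ.+ b i) · v i) ≈ sum (λ i → a i · v i) ∙ sum (λ i → b i · v i)
    sum-homo a b v = trans
      (sum-cong-≋ (λ i → ·-homo-+ (a i) (b i) (v i)))
      (∑-distrib-+ (λ i → a i · v i) (λ i → b i · v i))

  evaluate-homomorphism : IsHomomorphism (ℤ^ (l ℕ.+ l′)) abelianGroup evaluate
  evaluate-homomorphism = mkHomomorphism (ℤ^ (l ℕ.+ l′)) abelianGroup evaluate
    (λ e → ∙-cong
      (sum-cong-≋ (λ i → reflexive (≡.cong (_· y i) (e (i ↑ˡ l′)))))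
      (sum-cong-≋ (λ j → reflexive (≡.cong (_· y′ j) (e (l ↑ʳ j))))))
    (λ a b → trans
      (∙-cong (sum-homo (a ∘ (_↑ˡ l′)) (b ∘ (_↑ˡ l′)) y)
              (sum-homo (a ∘ (l ↑ʳ_)) (b ∘ (l ↑ʳ_)) y′))
      (interchange _ _ _ _))

  -- R(Y), the vectors a with Σ aᵢyᵢ + Σ aₗ₊ⱼy′ⱼ = 0.
  R⟨Y⟩ : Subgroup (ℤ^ (l ℕ.+ l′))
  R⟨Y⟩ = Ker {B = abelianGroup} evaluate evaluate-homomorphism

R₀ : (l l′ : ℕ) → Subgroup (ℤ^ (l ℕ.+ l′))
R₀ l l′ = record
  { Member    = λ a → (∀ (i : Fin l) → a (i ↑ˡ l′) ≡ ℤ.0ℤ) × (∀ (j : Fin l′) → + 2 ∣ a (l ↑ʳ j))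
  ; resp      = λ e (z , d) →
      (λ i → ≡.trans (≡.sym (e (i ↑ˡ l′))) (z i)) , (λ j → ≡.subst (+ 2 ∣_) (e (l ↑ʳ j)) (d j))
  ; ε-closed  = (λ _ → ≡.refl) , (λ _ → divides ℤ.0ℤ ≡.refl)
  ; ∙-closed  = λ (z , d) (z′ , d′) →
      (λ i → ≡.cong₂ ℤ._+_ (z i) (z′ i)) , (λ j → ∣m∣n⇒∣m+n (d j) (d′ j))
  ; ⁻¹-closed = λ (z , d) → (λ i → ≡.cong ℤ.-_ (z i)) , (λ j → ∣m⇒∣-m (d j))
  }

multiplesOf : (e n : ℕ) → Subgroup (ℤ^ n)
multiplesOf e n = record
  { Member    = λ a → ∀ i → + e ∣ a i
  ; resp      = λ eq d i → ≡.subst (+ e ∣_) (eq i) (d i)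
  ; ε-closed  = λ _ → divides ℤ.0ℤ ≡.refl
  ; ∙-closed  = λ d d′ i → ∣m∣n⇒∣m+n (d i) (d′ i)
  ; ⁻¹-closed = λ d i → ∣m⇒∣-m (d i)
  }

module _ {B : FiniteAbelianGroup} {Y : ConnectionSet B} {l l′ : ℕ} (L : Listing Y l l′)
         (F : FiniteAbelianGroup) where

  R : Subgroup (ℤ^ (l ℕ.+ l′))
  R = multiplesOf (exp B ℕ.* exp F) (l ℕ.+ l′)

  R̄⟨Y⟩ : Subgroup (ℤ^ (l ℕ.+ l′) / R)
  R̄⟨Y⟩ = R⟨Y⟩ L mod R

  R̄₀ : Subgroup (ℤ^ (l ℕ.+ l′) / R)
  R̄₀ = R₀ l l′ mod R

  -- The set of subgroups D with R̄₀ ⩽ D ⩽ R̄(Y), (ℤ^{l+l′}/R)/D ≅ A⁰ and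
  -- R̄(Y)/D ≅ F; two subgroups are equal when they have the same elements.
  AdmissibleSubgroups : (A⁰ : FiniteAbelianGroup) → Setoid (lsuc 0ℓ) 0ℓ
  AdmissibleSubgroups A⁰ = record
    { Carrier = Σ (Subgroup (ℤ^ (l ℕ.+ l′) / R)) λ D →
        D ⩽ R̄⟨Y⟩ ×
        R̄₀ ⩽ D ×
        (ℤ^ (l ℕ.+ l′) / R) / D ≅ abelianGroup A⁰ ×
        asGroup R̄⟨Y⟩ / restrict D R̄⟨Y⟩ ≅ abelianGroup F
    ; _≈_ = λ D E → Member (proj₁ D) ≐ Member (proj₁ E)
    ; isEquivalence = record
      { refl  = (λ m → m) , (λ m → m)
      ; sym   = λ (p , q) → q , p
      ; trans = λ (p , q) (p′ , q′) → (λ m → p′ (p m)) , (λ m → q (q′ m))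
      }
    }
    where open FiniteAbelianGroup using (abelianGroup)

{-# OPTIONS --safe #-}

-- In a typical covering f : A → B the connection set X lifts Y, so a ∈ ℤ^{l+l′}
-- can be evaluated on the lifts of the yᵢ and y′ⱼ instead.  This is a surjection
-- φ : ℤ^{l+l′} → A with f ∘ φ the evaluation on Y; its kernel K contains R₀,
-- because each −x′ⱼ is the lift of −y′ⱼ = y′ⱼ, and R, because exp(B) a lies in
-- ker f ≅ F for every a ∈ A.  The covering corresponds to D = K / R.  An isomorphism
-- of coverings maps the lift at g of a walk to the lift at the image of g, so it
-- preserves K; conversely A ≅ ℤ^{l+l′} / K, so K determines the covering, and
-- A = (ℤ^{l+l′} / R) / D with X the images of the unit vectors realises every D.

module Submission where

open import Algebra.Bundles using (AbelianGroup)
open import Algebra.Morphism.Structures using (module GroupMorphisms)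
import Algebra.Morphism.Construct.Composition as Composition
import Algebra.Properties.AbelianGroup as AbelianGroupProperties
import Algebra.Properties.CommutativeMonoid.Mult as Mult
import Algebra.Properties.CommutativeMonoid.Sum as Sum
import Algebra.Properties.CommutativeSemigroup as CommutativeSemigroupProperties
open import Data.Fin using (Fin; zero; suc; _↑ˡ_; _↑ʳ_; splitAt)
open import Data.Fin.Properties using (splitAt⁻¹-↑ˡ; splitAt⁻¹-↑ʳ)
open import Data.Integer as ℤ using (ℤ; +_; -[1+_]; 0ℤ; 1ℤ)
open import Data.Integer.Divisibility.Signed using (_∣_; divides; quotient; ∣ᵤ⇒∣; ∣-trans)
import Data.Integer.Properties as ℤ
open import Data.Nat as ℕ using (ℕ; zero; suc)
import Data.Nat.Divisibility as ℕ
import Data.Nat.Properties as ℕ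
open import Data.Product using (∃-syntax; _×_; _,_; proj₁; proj₂)
open import Data.Sum using (_⊎_; inj₁; inj₂; [_,_])
open import Data.Vec.Functional using (Vector; _∷_)
open import Function using (_∘_; id; const; StrictlySurjective; Injective; Inverse; Equivalence; mk⇔)
open import Function.Bundles using (Bijection)
import Function.Construct.Composition as Compose
open import Level using (0ℓ)
open import Relation.Binary using (Setoid)
open import Relation.Binary.PropositionalEquality as ≡ using (_≡_)
import Relation.Binary.Reasoning.Setoid as SetoidReasoning
open import Relation.Unary using (Pred; _≐_)
open import Defs

-- Homomorphisms, generation and quotients of abelian groups.

mkIsomorphism : (A B : AbGroup) (f : AbelianGroup.Carrier A → AbelianGroup.Carrier B) →
  IsHomomorphism A B f →
  Injective (AbelianGroup._≈_ A) (AbelianGroup._≈_ B) f →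
  StrictlySurjective (AbelianGroup._≈_ B) f → A ≅ B
mkIsomorphism A B f isHom inj surj = f , record
  { isGroupMonomorphism = record { isGroupHomomorphism = isHom ; injective = inj }
  ; surjective = λ b → let (a , fa≈b) = surj b in
      a , λ z≈a → AbelianGroup.trans B
        (GroupMorphisms.IsGroupHomomorphism.⟦⟧-cong isHom z≈a) fa≈b
  }

≅-trans : {A B C : AbGroup} → A ≅ B → B ≅ C → A ≅ C
≅-trans {C = C} (f , f-iso) (g , g-iso) =
  g ∘ f , Composition.isGroupIsomorphism (AbelianGroup.trans C) f-iso g-iso

≅⇒Inverse : {A B : AbGroup} → A ≅ B →
  Inverse (AbelianGroup.setoid A) (AbelianGroup.setoid B)
≅⇒Inverse {A} {B} (f , f-iso) = record
  { to        = f
  ; from      = λ b → proj₁ (surjective b)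
  ; to-cong   = ⟦⟧-cong
  ; from-cong = λ {b} {b′} b≈b′ →
      injective (B.trans (f∘f⁻¹ b) (B.trans b≈b′ (B.sym (f∘f⁻¹ b′))))
  ; inverse   = (λ {b} a≈ → B.trans (⟦⟧-cong a≈) (f∘f⁻¹ b)) ,
                (λ {a} {b} b≈ → injective (B.trans (f∘f⁻¹ b) b≈))
  }
  where
  module A = AbelianGroup A
  module B = AbelianGroup B
  open GroupMorphisms.IsGroupIsomorphism f-iso
  f∘f⁻¹ : ∀ b → f (proj₁ (surjective b)) B.≈ b
  f∘f⁻¹ b = proj₂ (surjective b) A.refl

module _ {G H : AbGroup} {f : AbelianGroup.Carrier G → AbelianGroup.Carrier H}
         (isHom : IsHomomorphism G H f) where
  private
    module G = AbelianGroup G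
    module H = AbelianGroup H
    module HP = AbelianGroupProperties H
    open Mult G.commutativeMonoid renaming (_×_ to _G·_) using ()
    open Mult H.commutativeMonoid renaming (_×_ to _H·_) using ()
  open GroupMorphisms.IsGroupHomomorphism isHom

  homo-difference : ∀ x y → f (x G.- y) H.≈ f x H.- f y
  homo-difference x y = H.trans (homo x (y G.⁻¹)) (H.∙-congˡ (⁻¹-homo y))

  difference∈Ker⇒≈ : ∀ x y → f (x G.- y) H.≈ H.ε → f x H.≈ f y
  difference∈Ker⇒≈ x y e =
    HP.x∙y⁻¹≈ε⇒x≈y (f x) (f y) (H.trans (H.sym (homo-difference x y)) e)

  ≈⇒difference∈Ker : ∀ x y → f x H.≈ f y → f (x G.- y) H.≈ H.ε
  ≈⇒difference∈Ker x y e = H.trans (homo-difference x y) (HP.x≈y⇒x∙y⁻¹≈ε e)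

  homo-· : ∀ n x → f (n G· x) H.≈ n H· f x
  homo-· zero    x = ε-homo
  homo-· (suc n) x = H.trans (homo x (n G· x)) (H.∙-congˡ (homo-· n x))

  ⟨⟩-map : {X : Pred G.Carrier 0ℓ} {Z : Pred H.Carrier 0ℓ} →
    (∀ {x} → X x → ⟨_⟩ {H} Z (f x)) → ∀ {a} → ⟨_⟩ {G} X a → ⟨_⟩ {H} Z (f a)
  ⟨⟩-map X⇒Z (gen x∈X)  = X⇒Z x∈X
  ⟨⟩-map X⇒Z (≈-cl e p) = ≈-cl (⟦⟧-cong e) (⟨⟩-map X⇒Z p)
  ⟨⟩-map X⇒Z ε-cl       = ≈-cl (H.sym ε-homo) ε-cl
  ⟨⟩-map X⇒Z (∙-cl p q) = ≈-cl (H.sym (homo _ _)) (∙-cl (⟨⟩-map X⇒Z p) (⟨⟩-map X⇒Z q))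
  ⟨⟩-map X⇒Z (⁻-cl p)   = ≈-cl (H.sym (⁻¹-homo _)) (⁻-cl (⟨⟩-map X⇒Z p))

  -- The image of a homomorphism is a subgroup, so it is enough to reach the generators.
  image-⟨⟩ : {Z : Pred H.Carrier 0ℓ} →
    (∀ {z} → Z z → ∃[ a ] f a H.≈ z) → ∀ {z} → ⟨_⟩ {H} Z z → ∃[ a ] f a H.≈ z
  image-⟨⟩ Z⇒ (gen z∈Z) = Z⇒ z∈Z
  image-⟨⟩ Z⇒ (≈-cl e p) = let (a , q) = image-⟨⟩ Z⇒ p in a , H.trans q e
  image-⟨⟩ Z⇒ ε-cl = G.ε , ε-homo
  image-⟨⟩ Z⇒ (∙-cl p q) =
    let (a , fa) = image-⟨⟩ Z⇒ p
        (b , fb) = image-⟨⟩ Z⇒ q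
    in a G.∙ b , H.trans (homo a b) (H.∙-cong fa fb)
  image-⟨⟩ Z⇒ (⁻-cl p) =
    let (a , fa) = image-⟨⟩ Z⇒ p in a G.⁻¹ , H.trans (⁻¹-homo a) (H.⁻¹-cong fa)

  homs-agree-on-⟨⟩ : {g : G.Carrier → H.Carrier} → IsHomomorphism G H g →
    {X : Pred G.Carrier 0ℓ} → (∀ {x} → X x → f x H.≈ g x) →
    ∀ {a} → ⟨_⟩ {G} X a → f a H.≈ g a
  homs-agree-on-⟨⟩ {g} g-hom {X} agree = go
    where
    module g = GroupMorphisms.IsGroupHomomorphism g-hom
    go : ∀ {a} → ⟨_⟩ {G} X a → f a H.≈ g a
    go (gen x∈X)  = agree x∈X
    go (≈-cl e p) = H.trans (⟦⟧-cong (G.sym e)) (H.trans (go p) (g.⟦⟧-cong e))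
    go ε-cl       = H.trans ε-homo (H.sym g.ε-homo)
    go (∙-cl p q) = H.trans (homo _ _) (H.trans (H.∙-cong (go p) (go q)) (H.sym (g.homo _ _)))
    go (⁻-cl p)   = H.trans (⁻¹-homo _) (H.trans (H.⁻¹-cong (go p)) (H.sym (g.⁻¹-homo _)))

module _ {G : AbGroup} where
  open AbelianGroup G
  open AbelianGroupProperties G

  -- H / N with exactly the members of H; unlike H mod N, it needs N ⩽ H.
  descend : (H N : Subgroup G) → N ⩽ H → Subgroup (G / N)
  descend H N N⩽H = record
    { Member    = Member H
    ; resp      = λ {x} {y} x-y∈N x∈H → H.resp (recover x y)
                    (H.∙-closed (H.⁻¹-closed (N⩽H x-y∈N)) x∈H)
    ; ε-closed  = H.ε-closed
    ; ∙-closed  = H.∙-closed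
    ; ⁻¹-closed = H.⁻¹-closed
    }
    where
    module H = Subgroup H
    recover : ∀ x y → (x - y) ⁻¹ ∙ x ≈ y
    recover x y = trans (∙-congʳ (⁻¹-anti-homo‿- x y)) (//-rightDividesˡ x y)

  /-isHomomorphism : (N : Subgroup G) → IsHomomorphism G (G / N) id
  /-isHomomorphism N = mkHomomorphism G (G / N) id
    (λ e → N.resp (sym (x≈y⇒x∙y⁻¹≈ε e)) N.ε-closed) (λ _ _ → AbelianGroup.refl (G / N))
    where module N = Subgroup N

  -- A member of `H mod N` is only congruent to some `h` in `H`; the error lies in `N`, which `K`
  -- absorbs. The conclusion is about representatives, since `K` is a subgroup of `G` and not of
  -- `G / N`.
  mod-⩽ : (H N K : Subgroup G) (N⩽K : N ⩽ K) → H ⩽ K →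
    ∀ {a} → Member (H mod N) a → Member K a
  mod-⩽ H N K N⩽K H⩽K (h , h∈H , h≈a) = Subgroup.resp (descend K N N⩽K) h≈a (H⩽K h∈H)

  ⩽-mod : (H N : Subgroup G) → ∀ {a} → Member H a → Member (H mod N) a
  ⩽-mod H N {a} a∈H = a , a∈H , AbelianGroup.refl (G / N)

proj₁-isHomomorphism : {G : AbGroup} (H : Subgroup G) → IsHomomorphism (asGroup H) G proj₁
proj₁-isHomomorphism {G} H = mkHomomorphism (asGroup H) G proj₁ id (λ _ _ → AbelianGroup.refl G)

≅-annihilated : {G H : AbGroup} → G ≅ H → ∀ s →
  (∀ h → AbelianGroup._≈_ H (Mult._×_ (AbelianGroup.commutativeMonoid H) s h) (AbelianGroup.ε H)) →
  ∀ g → AbelianGroup._≈_ G (Mult._×_ (AbelianGroup.commutativeMonoid G) s g) (AbelianGroup.ε G)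
≅-annihilated {G} {H} (f , f-iso) s s-kills g =
  injective (H.trans (homo-· {G} {H} isGroupHomomorphism s g) (H.trans (s-kills (f g)) (H.sym ε-homo)))
  where
  module H = AbelianGroup H
  open GroupMorphisms.IsGroupIsomorphism f-iso

-- Generators of ℤⁿ and integer combinations

-- The recursion follows the head and tail of a vector, as the inductions in `δ-generates` and
-- `sum-δ` do.
δ : ∀ {n} → Fin n → Vector ℤ n
δ zero    = 1ℤ ∷ const 0ℤ
δ (suc i) = 0ℤ ∷ δ i

δ-↑ˡ-↑ˡ : ∀ {m} n (i j : Fin m) → δ (i ↑ˡ n) (j ↑ˡ n) ≡ δ i j
δ-↑ˡ-↑ˡ n zero    zero    = ≡.refl
δ-↑ˡ-↑ˡ n zero    (suc j) = ≡.refl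
δ-↑ˡ-↑ˡ n (suc i) zero    = ≡.refl
δ-↑ˡ-↑ˡ n (suc i) (suc j) = δ-↑ˡ-↑ˡ n i j

δ-↑ˡ-↑ʳ : ∀ {m n} (i : Fin m) (j : Fin n) → δ (i ↑ˡ n) (m ↑ʳ j) ≡ 0ℤ
δ-↑ˡ-↑ʳ zero    j = ≡.refl
δ-↑ˡ-↑ʳ (suc i) j = δ-↑ˡ-↑ʳ i j

δ-↑ʳ-↑ˡ : ∀ {m n} (i : Fin n) (j : Fin m) → δ (m ↑ʳ i) (j ↑ˡ n) ≡ 0ℤ
δ-↑ʳ-↑ˡ i zero    = ≡.refl
δ-↑ʳ-↑ˡ i (suc j) = δ-↑ʳ-↑ˡ i j

δ-↑ʳ-↑ʳ : ∀ m {n} (i j : Fin n) → δ (m ↑ʳ i) (m ↑ʳ j) ≡ δ i j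
δ-↑ʳ-↑ʳ zero    i j = ≡.refl
δ-↑ʳ-↑ʳ (suc m) i j = δ-↑ʳ-↑ʳ m i j

1-generates : ∀ z → ⟨_⟩ {ℤ.+-0-abelianGroup} (_≡ 1ℤ) z
1-generates (+ n)    = natural n
  where
  natural : ∀ n → ⟨_⟩ {ℤ.+-0-abelianGroup} (_≡ 1ℤ) (+ n)
  natural zero    = ε-cl
  natural (suc n) = ∙-cl (gen ≡.refl) (natural n)
1-generates -[1+ n ] = ⁻-cl (1-generates (+ suc n))

δ-generates : ∀ n (a : Vector ℤ n) → ⟨_⟩ {ℤ^ n} (λ b → ∃[ i ] b ≡ δ i) a
δ-generates zero    a = ≈-cl (λ ()) ε-cl
-- The vector is its head plus its tail; each summand is the image of ℤ or ℤⁿ under an embedding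
-- that carries generators to generators.
δ-generates (suc n) a = ≈-cl split
  (∙-cl (⟨⟩-map head-hom (λ { ≡.refl → gen (zero , ≡.refl) }) (1-generates (a zero)))
        (⟨⟩-map tail-hom (λ { (i , ≡.refl) → gen (suc i , ≡.refl) }) (δ-generates n (a ∘ suc))))
  where
  head-hom : IsHomomorphism ℤ.+-0-abelianGroup (ℤ^ (suc n)) (_∷ const 0ℤ)
  head-hom = mkHomomorphism ℤ.+-0-abelianGroup (ℤ^ (suc n)) _
    (λ { ≡.refl i → ≡.refl }) (λ { _ _ zero → ≡.refl ; _ _ (suc i) → ≡.refl })
  tail-hom : IsHomomorphism (ℤ^ n) (ℤ^ (suc n)) (0ℤ ∷_)
  tail-hom = mkHomomorphism (ℤ^ n) (ℤ^ (suc n)) _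
    (λ { e zero → ≡.refl ; e (suc i) → e i }) (λ { _ _ zero → ≡.refl ; _ _ (suc i) → ≡.refl })
  split : ∀ i → (a zero ∷ const 0ℤ) i ℤ.+ (0ℤ ∷ (a ∘ suc)) i ≡ a i
  split zero    = ℤ.+-identityʳ (a zero)
  split (suc i) = ℤ.+-identityˡ (a (suc i))

-- The coordinatewise quotients form a vector `q` with a = s q, whence f a = s f(q) = 0. It serves
-- for B with s = exp(B) and for A with s = exp(B) exp(F).
multiplesOf⩽Ker : ∀ {n} {H : AbGroup} {f : Vector ℤ n → AbelianGroup.Carrier H}
  (isHom : IsHomomorphism (ℤ^ n) H f) (s : ℕ) →
  (∀ h → AbelianGroup._≈_ H (Mult._×_ (AbelianGroup.commutativeMonoid H) s h) (AbelianGroup.ε H)) →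
  multiplesOf s n ⩽ Ker {B = H} f isHom
multiplesOf⩽Ker {n} {H} {f} isHom s s-kills {a} s∣a = begin
  f a         ≈⟨ ⟦⟧-cong (λ i → ≡.trans (_∣_.equality (s∣a i)) (≡.sym (multiple s i))) ⟩
  f (s G· q)  ≈⟨ homo-· {ℤ^ n} {H} isHom s q ⟩
  s H· f q    ≈⟨ s-kills (f q) ⟩
  ε           ∎
  where
  open AbelianGroup H
  open SetoidReasoning setoid
  open GroupMorphisms.IsGroupHomomorphism isHom
  open Mult (AbelianGroup.commutativeMonoid (ℤ^ n)) using () renaming (_×_ to _G·_)
  open Mult commutativeMonoid using () renaming (_×_ to _H·_)
  q : Vector ℤ n
  q i = quotient (s∣a i)
  multiple : ∀ t i → (t G· q) i ≡ q i ℤ.* + t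
  multiple zero    i = ≡.sym (ℤ.*-zeroʳ (q i))
  multiple (suc t) i = ≡.trans (≡.cong (λ z → q i ℤ.+ z) (multiple t i)) (≡.sym (ℤ.*-suc (q i) (+ t)))

module _ (B : AbGroup) where
  open AbelianGroup B
  open AbelianGroupProperties B
  open IntegerMultiples B
  open Sum commutativeMonoid
  open CommutativeSemigroupProperties commutativeSemigroup using (interchange)

  sum-0· : ∀ {n} (a : Vector ℤ n) (v : Vector Carrier n) → (∀ i → a i ≡ 0ℤ) →
    sum (λ i → a i · v i) ≈ ε
  sum-0· {n} a v a≡0 =
    trans (sum-cong-≋ (λ i → reflexive (≡.cong (_· v i) (a≡0 i)))) (sum-replicate-zero n)

  -- The coefficients are only pointwise equal to `δ i` because they will be one block of a unit
  -- vector of ℤ^{l+l′}.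
  sum-δ : ∀ {n} (i : Fin n) (a : Vector ℤ n) (v : Vector Carrier n) → (∀ j → a j ≡ δ i j) →
    sum (λ j → a j · v j) ≈ v i
  sum-δ zero    a v a≡δ = trans
    (∙-cong (trans (reflexive (≡.cong (_· v zero) (a≡δ zero))) (identityʳ _))
            (sum-0· (a ∘ suc) (v ∘ suc) (a≡δ ∘ suc)))
    (identityʳ _)
  sum-δ (suc i) a v a≡δ = trans
    (∙-cong (reflexive (≡.cong (_· v zero) (a≡δ zero))) (sum-δ i (a ∘ suc) (v ∘ suc) (a≡δ ∘ suc)))
    (identityˡ _)

  2·-kills : ∀ {b} → b ∙ b ≈ ε → ∀ q → (q ℤ.* + 2) · b ≈ ε
  2·-kills {b} 2b≈ε q = begin
    (q ℤ.* + 2) · b          ≡⟨ ≡.cong (_· b) (ℤ.*-suc q 1ℤ) ⟩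
    (q ℤ.+ q ℤ.* + 1) · b    ≡⟨ ≡.cong (λ z → (q ℤ.+ z) · b) (ℤ.*-identityʳ q) ⟩
    (q ℤ.+ q) · b            ≈⟨ ·-homo-+ q q b ⟩
    q · b ∙ q · b            ≈⟨ double q ⟩
    ε                        ∎
    where
    open SetoidReasoning setoid
    doubleℕ : ∀ n → (+ n) · b ∙ (+ n) · b ≈ ε
    doubleℕ zero    = identityˡ ε
    doubleℕ (suc n) = trans (interchange _ _ _ _)
      (trans (∙-cong 2b≈ε (doubleℕ n)) (identityˡ ε))
    double : ∀ q → q · b ∙ q · b ≈ ε
    double (+ n)    = doubleℕ n
    double -[1+ n ] = trans (⁻¹-∙-comm _ _) (trans (⁻¹-cong (doubleℕ (suc n))) ε⁻¹≈ε)

  sum-2· : ∀ {n} (a : Vector ℤ n) (v : Vector Carrier n) →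
    (∀ i → v i ∙ v i ≈ ε) → (∀ i → + 2 ∣ a i) → sum (λ i → a i · v i) ≈ ε
  sum-2· {n} a v 2v≈ε 2∣a = trans (sum-cong-≋ vanish) (sum-replicate-zero n)
    where
    vanish : ∀ i → a i · v i ≈ ε
    vanish i with divides q a≡ ← 2∣a i = trans (reflexive (≡.cong (_· v i) a≡)) (2·-kills (2v≈ε i) q)

-- Index and negate mirror Listing.listed: inj₁ i, inj₂ (inj₁ i) and
-- inj₂ (inj₂ j) stand for yᵢ, -yᵢ and y′ⱼ.
Index : ℕ → ℕ → Set
Index l l′ = Fin l ⊎ Fin l ⊎ Fin l′

negate : ∀ {l l′} → Index l l′ → Index l l′
negate (inj₁ i)        = inj₂ (inj₁ i)
negate (inj₂ (inj₁ i)) = inj₁ i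
negate (inj₂ (inj₂ j)) = inj₂ (inj₂ j)

-- The signs make `evaluate` send `unit k` to `listed k` for every `k`, so each edge direction of
-- the Cayley graph comes from one of these vectors.
unit : ∀ {l l′} → Index l l′ → Vector ℤ (l ℕ.+ l′)
unit {l} {l′} (inj₁ i)        = δ (i ↑ˡ l′)
unit {l} {l′} (inj₂ (inj₁ i)) = ℤ.-_ ∘ δ (i ↑ˡ l′)
unit {l} {l′} (inj₂ (inj₂ j)) = δ (l ↑ʳ j)

units-generate : ∀ l l′ (a : Vector ℤ (l ℕ.+ l′)) →
  ⟨_⟩ {ℤ^ (l ℕ.+ l′)} (λ b → ∃[ k ] b ≡ unit {l} {l′} k) a
units-generate l l′ a =
  ⟨⟩-map {ℤ^ (l ℕ.+ l′)} {ℤ^ (l ℕ.+ l′)}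
    (mkHomomorphism (ℤ^ (l ℕ.+ l′)) (ℤ^ (l ℕ.+ l′)) id id (λ _ _ _ → ≡.refl))
    (λ { (i , ≡.refl) → δ-is-unit i }) (δ-generates (l ℕ.+ l′) a)
  where
  δ-is-unit : ∀ i → ⟨_⟩ {ℤ^ (l ℕ.+ l′)} (λ b → ∃[ k ] b ≡ unit {l} {l′} k) (δ i)
  δ-is-unit i with splitAt l i in eq
  ... | inj₁ i₁ = gen (inj₁ i₁ , ≡.cong δ (≡.sym (splitAt⁻¹-↑ˡ eq)))
  ... | inj₂ i₂ = gen (inj₂ (inj₂ i₂) , ≡.cong δ (≡.sym (splitAt⁻¹-↑ʳ {m = l} {i = i} eq)))

homs-agree-on-units : ∀ {l l′} {H : AbGroup} {f g : Vector ℤ (l ℕ.+ l′) → AbelianGroup.Carrier H} →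
  IsHomomorphism (ℤ^ (l ℕ.+ l′)) H f → IsHomomorphism (ℤ^ (l ℕ.+ l′)) H g →
  (∀ k → AbelianGroup._≈_ H (f (unit {l} {l′} k)) (g (unit {l} {l′} k))) →
  ∀ a → AbelianGroup._≈_ H (f a) (g a)
homs-agree-on-units {l} {l′} {H} f-hom g-hom agree a =
  homs-agree-on-⟨⟩ {ℤ^ (l ℕ.+ l′)} {H} f-hom g-hom
    (λ { (k , ≡.refl) → agree k }) (units-generate l l′ a)

-- Evaluation of integer vectors on a listing.

module _ {B : FiniteAbelianGroup} {Y : ConnectionSet B} {l l′ : ℕ} (L : Listing Y l l′) where
  open FiniteAbelianGroup B
  open Listing L
  open GroupMorphisms.IsGroupHomomorphism (evaluate-homomorphism L) using (⁻¹-homo)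

  listed∈ : ∀ k → Elem Y (listed k)
  listed∈ k = proj₂ lists (k , refl)

  evaluate-unit : ∀ k → evaluate L (unit k) ≈ listed k
  evaluate-unit (inj₁ i) = trans
    (∙-cong (sum-δ abelianGroup i _ y (δ-↑ˡ-↑ˡ l′ i)) (sum-0· abelianGroup _ y′ (δ-↑ˡ-↑ʳ i)))
    (identityʳ (y i))
  evaluate-unit (inj₂ (inj₁ i)) =
    trans (⁻¹-homo (δ (i ↑ˡ l′))) (⁻¹-cong (evaluate-unit (inj₁ i)))
  evaluate-unit (inj₂ (inj₂ j)) = trans
    (∙-cong (sum-0· abelianGroup _ y (δ-↑ʳ-↑ˡ j)) (sum-δ abelianGroup j _ y′ (δ-↑ʳ-↑ʳ l j)))
    (identityˡ (y′ j))

  evaluate-surjective : StrictlySurjective _≈_ (evaluate L)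
  evaluate-surjective b =
    image-⟨⟩ {ℤ^ (l ℕ.+ l′)} {abelianGroup} (evaluate-homomorphism L) hit (ConnectionSet.generates Y b)
    where
    hit : ∀ {z} → Elem Y z → ∃[ a ] evaluate L a ≈ z
    hit z∈Y = let (k , z≈) = proj₁ lists z∈Y in unit k , trans (evaluate-unit k) (sym z≈)

  -- Even multiples of the involutions vanish. This is meant for the lifted listing of X, where it
  -- gives `R̄₀⩽D`.
  R₀⩽R⟨Y⟩ : R₀ l l′ ⩽ R⟨Y⟩ L
  R₀⩽R⟨Y⟩ (z , d) = trans
    (∙-cong (sum-0· abelianGroup _ y z) (sum-2· abelianGroup _ y′ 2y′≈0 d)) (identityˡ ε)

exp-kills : (A : FiniteAbelianGroup) → let open FiniteAbelianGroup A in
  ∀ a → Mult._×_ commutativeMonoid (exp A) a ≈ ε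
exp-kills A = proj₂ (proj₁ (proj₂ (exponent A)))

module _ {B : FiniteAbelianGroup} {Y : ConnectionSet B} {l l′ : ℕ} (L : Listing Y l l′)
         (F : FiniteAbelianGroup) where

  -- exp(B) divides exp(B) exp(F) and annihilates B. Hence every representative of a member of R̄(Y)
  -- itself lies in R(Y).
  R⩽R⟨Y⟩ : R L F ⩽ R⟨Y⟩ L
  R⩽R⟨Y⟩ a∈R = multiplesOf⩽Ker {H = FiniteAbelianGroup.abelianGroup B} (evaluate-homomorphism L) (exp B)
    (exp-kills B) (λ i → ∣-trans (∣ᵤ⇒∣ (ℕ.m∣m*n (exp F))) (a∈R i))

-- Lifting along a typical covering

module Lifts {B : FiniteAbelianGroup} {Y : ConnectionSet B} {l l′ : ℕ} (L : Listing Y l l′)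
             (c : TypicalCovering B Y) where
  open TypicalCovering c using (A; X; f; isHomomorphism; bijective; kernel)
  private
    module A = FiniteAbelianGroup A
    module B = FiniteAbelianGroup B
    module BP = AbelianGroupProperties B.abelianGroup
    module f = GroupMorphisms.IsGroupHomomorphism isHomomorphism
    module f|X = BijectiveOn bijective
    module L = Listing L

  lift : ∀ k → ∃[ x ] (Elem X x × f x B.≈ L.listed k)
  lift k = f|X.surjective (listed∈ L k)

  private
    y : Fin l → A.Carrier
    y i = proj₁ (lift (inj₁ i))
    y′ : Fin l′ → A.Carrier
    y′ j = proj₁ (lift (inj₂ (inj₂ j)))

  -- Over -yᵢ this takes the negative of the lift of yᵢ, not an independently chosen lift, so that
  -- it agrees by definition with the `listed` of `lifted`.
  listed-X : Index l l′ → A.Carrier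
  listed-X = [ y , [ (λ i → y i A.⁻¹) , y′ ] ]

  listed-X∈X : ∀ k → Elem X (listed-X k)
  listed-X∈X (inj₁ i)        = proj₁ (proj₂ (lift (inj₁ i)))
  listed-X∈X (inj₂ (inj₁ i)) = ConnectionSet.symmetric X (listed-X∈X (inj₁ i))
  listed-X∈X (inj₂ (inj₂ j)) = proj₁ (proj₂ (lift (inj₂ (inj₂ j))))

  f-listed : ∀ k → f (listed-X k) B.≈ L.listed k
  f-listed (inj₁ i)        = proj₂ (proj₂ (lift (inj₁ i)))
  f-listed (inj₂ (inj₁ i)) = B.trans (f.⁻¹-homo _) (B.⁻¹-cong (f-listed (inj₁ i)))
  f-listed (inj₂ (inj₂ j)) = proj₂ (proj₂ (lift (inj₂ (inj₂ j))))

  listed-unique : ∀ {x} → Elem X x → ∀ k → f x B.≈ L.listed k → x A.≈ listed-X k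
  listed-unique x∈X k fx≈ =
    f|X.injective x∈X (listed-X∈X k) (B.trans fx≈ (B.sym (f-listed k)))

  -- With X listed in the same pattern as Y, everything proved about `evaluate` applies to A as
  -- well.
  lifted : Listing X l l′
  lifted = record
    { y        = y
    ; y′       = y′
    ; 2y≉0     = λ i 2y≈0 → L.2y≉0 i (B.trans (B.sym (B.∙-cong (f-listed (inj₁ i)) (f-listed (inj₁ i))))
        (B.trans (B.sym (f.homo _ _)) (B.trans (f.⟦⟧-cong 2y≈0) f.ε-homo)))
    ; 2y′≈0    = 2y′≈0
    ; distinct = λ {k} {k′} e → L.distinct
        (B.trans (B.sym (f-listed k)) (B.trans (f.⟦⟧-cong e) (f-listed k′)))
    ; lists    = (λ x∈X → let (k , fx≈) = proj₁ L.lists (f|X.maps x∈X) in k , listed-unique x∈X k fx≈)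
               , (λ (k , x≈) → ConnectionSet.resp X (A.sym x≈) (listed-X∈X k))
    }
    where
    -- −x′ⱼ lies in X over −y′ⱼ = y′ⱼ, so it is x′ⱼ.
    2y′≈0 : ∀ j → y′ j A.∙ y′ j A.≈ A.ε
    2y′≈0 j = A.trans (A.∙-congʳ (A.sym -y′≈y′)) (A.inverseˡ (y′ j))
      where
      k : Index l l′
      k = inj₂ (inj₂ j)
      -y′≈y′ : y′ j A.⁻¹ A.≈ y′ j
      -y′≈y′ = listed-unique (ConnectionSet.symmetric X (listed-X∈X k)) k
        (B.trans (f.⁻¹-homo _) (B.trans (B.⁻¹-cong (f-listed k))
          (B.sym (BP.inverseˡ-unique _ _ (L.2y′≈0 j)))))

  φ : Vector ℤ (l ℕ.+ l′) → A.Carrier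
  φ = evaluate lifted

  φ-hom : IsHomomorphism (ℤ^ (l ℕ.+ l′)) A.abelianGroup φ
  φ-hom = evaluate-homomorphism lifted

  f∘φ : ∀ a → f (φ a) B.≈ evaluate L a
  f∘φ = homs-agree-on-units {l} {l′} {B.abelianGroup} f∘φ-hom (evaluate-homomorphism L)
    (λ k → B.trans (f.⟦⟧-cong (evaluate-unit lifted k))
      (B.trans (f-listed k) (B.sym (evaluate-unit L k))))
    where
    f∘φ-hom : IsHomomorphism (ℤ^ (l ℕ.+ l′)) B.abelianGroup (f ∘ φ)
    f∘φ-hom = Composition.isGroupHomomorphism B.trans φ-hom isHomomorphism

  K : Subgroup (ℤ^ (l ℕ.+ l′))
  K = R⟨Y⟩ lifted

  K⇒≈ : ∀ a b → Member K (λ i → a i ℤ.+ ℤ.- b i) → φ a A.≈ φ b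
  K⇒≈ = difference∈Ker⇒≈ {ℤ^ (l ℕ.+ l′)} {A.abelianGroup} φ-hom

  ≈⇒K : ∀ a b → φ a A.≈ φ b → Member K (λ i → a i ℤ.+ ℤ.- b i)
  ≈⇒K = ≈⇒difference∈Ker {ℤ^ (l ℕ.+ l′)} {A.abelianGroup} φ-hom

  K⩽R⟨Y⟩ : K ⩽ R⟨Y⟩ L
  K⩽R⟨Y⟩ {a} φa≈ε = B.trans (B.sym (f∘φ a)) (B.trans (f.⟦⟧-cong φa≈ε) f.ε-homo)

  module _ {F : FiniteAbelianGroup} (kernel≅F : asGroup kernel ≅ FiniteAbelianGroup.abelianGroup F) where
    open Mult A.commutativeMonoid using (×-assocˡ) renaming (_×_ to _·_)

    exp-product-kills : ∀ a → (exp B ℕ.* exp F) · a A.≈ A.ε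
    exp-product-kills a = begin
      (exp B ℕ.* exp F) · a    ≡⟨ ≡.cong (_· a) (ℕ.*-comm (exp B) (exp F)) ⟩
      (exp F ℕ.* exp B) · a    ≈⟨ ×-assocˡ a (exp F) (exp B) ⟨
      -- The multiple by exp(F) is taken inside the kernel, where F controls it, and carried to A by
      -- the inclusion `proj₁`.
      exp F · (exp B · a)      ≈⟨ homo-· {asGroup kernel} {A.abelianGroup}
                                    (proj₁-isHomomorphism kernel) (exp F) (exp B · a , in-kernel) ⟨
      _                        ≈⟨ ≅-annihilated {asGroup kernel} {FiniteAbelianGroup.abelianGroup F}
                                    kernel≅F (exp F) (exp-kills F) (exp B · a , in-kernel) ⟩
      A.ε                      ∎
      where
      open SetoidReasoning A.setoid
      in-kernel : f (exp B · a) B.≈ B.ε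
      in-kernel = B.trans (homo-· {A.abelianGroup} {B.abelianGroup} isHomomorphism (exp B) a) (exp-kills B (f a))

    R⩽K : R L F ⩽ K
    R⩽K = multiplesOf⩽Ker {H = A.abelianGroup} φ-hom (exp B ℕ.* exp F) exp-product-kills

    D : Subgroup (ℤ^ (l ℕ.+ l′) / R L F)
    D = descend K (R L F) R⩽K

    D⩽R̄⟨Y⟩ : D ⩽ R̄⟨Y⟩ L F
    D⩽R̄⟨Y⟩ {a} a∈D = ⩽-mod (R⟨Y⟩ L) (R L F) {a} (K⩽R⟨Y⟩ {a} a∈D)

    R̄₀⩽D : R̄₀ L F ⩽ D
    R̄₀⩽D = mod-⩽ (R₀ l l′) (R L F) K R⩽K (λ {a} → R₀⩽R⟨Y⟩ lifted {a})

    -- This is the first isomorphism theorem for `φ`: the iterated quotient still consists of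
    -- integer vectors, and its equality is membership of the difference in `K`.
    quotient≅A : (ℤ^ (l ℕ.+ l′) / R L F) / D ≅ A.abelianGroup
    quotient≅A = mkIsomorphism (ℤ^ (l ℕ.+ l′) / R L F / D) A.abelianGroup φ
      (mkHomomorphism (ℤ^ (l ℕ.+ l′) / R L F / D) A.abelianGroup φ (λ {a} {b} → K⇒≈ a b)
        (GroupMorphisms.IsGroupHomomorphism.homo φ-hom))
      (λ {a} {b} → ≈⇒K a b)
      (evaluate-surjective lifted)

    -- By `f∘φ` the preimage of ker f under `φ` is R(Y), so `φ` restricts to a surjection from R(Y)
    -- onto ker f with kernel `K`.
    quotient≅kernel : asGroup (R̄⟨Y⟩ L F) / restrict D (R̄⟨Y⟩ L F) ≅ asGroup kernel
    quotient≅kernel = mkIsomorphism Q (asGroup kernel) g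
      (mkHomomorphism Q (asGroup kernel) g (λ {(a , _)} {(b , _)} → K⇒≈ a b)
        (λ (a , _) (b , _) → GroupMorphisms.IsGroupHomomorphism.homo φ-hom a b))
      (λ {(a , _)} {(b , _)} → ≈⇒K a b)
      (λ (x , fx≈ε) → let (a , φa≈x) = evaluate-surjective lifted x in
        (a , ⩽-mod (R⟨Y⟩ L) (R L F) {a}
          (B.trans (B.sym (f∘φ a)) (B.trans (f.⟦⟧-cong φa≈x) fx≈ε))) , φa≈x)
      where
      Q : AbGroup
      Q = asGroup (R̄⟨Y⟩ L F) / restrict D (R̄⟨Y⟩ L F)
      g : AbelianGroup.Carrier Q → AbelianGroup.Carrier (asGroup kernel)
      g (a , a∈R̄) = φ a ,
        B.trans (f∘φ a) (mod-⩽ (R⟨Y⟩ L) (R L F) (R⟨Y⟩ L) (R⩽R⟨Y⟩ L F) id {a} a∈R̄)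

-- Isomorphism of coverings as equality of the subgroups K.

module _ {B : FiniteAbelianGroup} {Y : ConnectionSet B} {l l′ : ℕ} (L : Listing Y l l′)
         (c₁ c₂ : TypicalCovering B Y) where
  private
    module B = FiniteAbelianGroup B
    module BP = AbelianGroupProperties B.abelianGroup
    module C₁ = TypicalCovering c₁
    module C₂ = TypicalCovering c₂
    module A₁ = FiniteAbelianGroup C₁.A
    module A₂ = FiniteAbelianGroup C₂.A
    module P₁ = AbelianGroupProperties A₁.abelianGroup
    module P₂ = AbelianGroupProperties A₂.abelianGroup
    module L₁ = Lifts L c₁
    module L₂ = Lifts L c₂
    module f₁ = GroupMorphisms.IsGroupHomomorphism C₁.isHomomorphism
    module f₂ = GroupMorphisms.IsGroupHomomorphism C₂.isHomomorphism
    module φ₁ = GroupMorphisms.IsGroupHomomorphism L₁.φ-hom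
    module φ₂ = GroupMorphisms.IsGroupHomomorphism L₂.φ-hom

  -- A graph isomorphism is not assumed to be additive or to fix 0, but it preserves the labels of
  -- edges, so Φ(g + φ₁ a) = Φ(g) + φ₂ a. For `a` in K₁ and g = 0 this reads Φ(0) = Φ(0) + φ₂ a.
  isomorphic⇒K⩽K : IsomorphicCoverings C₁.covering C₂.covering → L₁.K ⩽ L₂.K
  isomorphic⇒K⩽K (Φ , comm) {a} φ₁a≈ε = P₂.identityʳ-unique (Φ.to A₁.ε) (L₂.φ a)
    (A₂.trans (A₂.sym (walk (units-generate l l′ a) A₁.ε))
      (Inverse.to-cong Φ.bijection (A₁.trans (A₁.identityˡ _) φ₁a≈ε)))
    where
    module Φ = GraphIsomorphism Φ
    open Listing L using (listed)

    step : ∀ k g → Φ.to (g A₁.∙ L₁.listed-X k) A₂.≈ Φ.to g A₂.∙ L₂.listed-X k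
    step k g with Equivalence.to (Φ.adjacency g (g A₁.∙ L₁.listed-X k))
                    (L₁.listed-X k , L₁.listed-X∈X k , A₁.refl)
    -- Adjacency yields some `x` in X₂; projecting the edge to B shows that `x` lies over
    -- `listed k`, which determines it.
    ... | x , x∈X , to≈ = A₂.trans to≈ (A₂.∙-congˡ (L₂.listed-unique x∈X k
     (BP.∙-cancelˡ (C₂.f (Φ.to g)) _ _ (begin
      C₂.f (Φ.to g) B.∙ C₂.f x            ≈⟨ f₂.homo _ _ ⟨
      C₂.f (Φ.to g A₂.∙ x)                ≈⟨ f₂.⟦⟧-cong to≈ ⟨
      C₂.f (Φ.to (g A₁.∙ L₁.listed-X k))  ≈⟨ comm _ ⟩
      C₁.f (g A₁.∙ L₁.listed-X k)         ≈⟨ f₁.homo _ _ ⟩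
      C₁.f g B.∙ C₁.f (L₁.listed-X k)     ≈⟨ B.∙-cong (B.sym (comm g)) (L₁.f-listed k) ⟩
      C₂.f (Φ.to g) B.∙ listed k          ∎))))
      where open SetoidReasoning B.setoid

    walk : ∀ {a} → ⟨_⟩ {ℤ^ (l ℕ.+ l′)} (λ b → ∃[ k ] b ≡ unit {l} {l′} k) a →
      ∀ g → Φ.to (g A₁.∙ L₁.φ a) A₂.≈ Φ.to g A₂.∙ L₂.φ a
    walk (gen (k , ≡.refl)) g = A₂.trans
      (Inverse.to-cong Φ.bijection (A₁.∙-congˡ (evaluate-unit L₁.lifted k)))
      (A₂.trans (step k g) (A₂.∙-congˡ (A₂.sym (evaluate-unit L₂.lifted k))))
    walk (≈-cl {a} {b} e p) g = A₂.trans
      (Inverse.to-cong Φ.bijection (A₁.∙-congˡ (φ₁.⟦⟧-cong {b} {a} (λ i → ≡.sym (e i)))))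
      (A₂.trans (walk p g) (A₂.∙-congˡ (φ₂.⟦⟧-cong e)))
    walk ε-cl g = A₂.trans
      (Inverse.to-cong Φ.bijection (A₁.trans (A₁.∙-congˡ φ₁.ε-homo) (A₁.identityʳ g)))
      (A₂.sym (A₂.trans (A₂.∙-congˡ φ₂.ε-homo) (A₂.identityʳ _)))
    walk (∙-cl {a} {b} p q) g = begin
      Φ.to (g A₁.∙ L₁.φ (λ i → a i ℤ.+ b i))    ≈⟨ Inverse.to-cong Φ.bijection (A₁.trans
                                                     (A₁.∙-congˡ (φ₁.homo a b)) (A₁.sym (A₁.assoc _ _ _))) ⟩
      Φ.to (g A₁.∙ L₁.φ a A₁.∙ L₁.φ b)          ≈⟨ walk q _ ⟩
      Φ.to (g A₁.∙ L₁.φ a) A₂.∙ L₂.φ b          ≈⟨ A₂.∙-congʳ (walk p g) ⟩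
      Φ.to g A₂.∙ L₂.φ a A₂.∙ L₂.φ b            ≈⟨ A₂.assoc _ _ _ ⟩
      Φ.to g A₂.∙ (L₂.φ a A₂.∙ L₂.φ b)          ≈⟨ A₂.∙-congˡ (φ₂.homo a b) ⟨
      Φ.to g A₂.∙ L₂.φ (λ i → a i ℤ.+ b i)      ∎
      where open SetoidReasoning A₂.setoid
    -- The hypothesis for `a` is used from the start g - φ₁ a, where the walk ends at `g`; this is
    -- why `walk` quantifies over all starting points.
    walk (⁻-cl {a} p) g = begin
      Φ.to (g A₁.∙ L₁.φ (λ i → ℤ.- a i))                            ≈⟨ P₂.//-rightDividesʳ (L₂.φ a) _ ⟨
      Φ.to (g A₁.∙ L₁.φ (λ i → ℤ.- a i)) A₂.∙ L₂.φ a A₂.- L₂.φ a    ≈⟨ A₂.∙-congʳ (walk p _) ⟨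
      Φ.to (g A₁.∙ L₁.φ (λ i → ℤ.- a i) A₁.∙ L₁.φ a) A₂.- L₂.φ a    ≈⟨ A₂.∙-congʳ (Inverse.to-cong Φ.bijection cancel) ⟩
      Φ.to g A₂.- L₂.φ a                                            ≈⟨ A₂.∙-congˡ (φ₂.⁻¹-homo a) ⟨
      Φ.to g A₂.∙ L₂.φ (λ i → ℤ.- a i)                              ∎
      where
      open SetoidReasoning A₂.setoid
      cancel : g A₁.∙ L₁.φ (λ i → ℤ.- a i) A₁.∙ L₁.φ a A₁.≈ g
      cancel = A₁.trans (A₁.∙-congʳ (A₁.∙-congˡ (φ₁.⁻¹-homo a))) (P₁.//-rightDividesˡ (L₁.φ a) g)

module _ {B : FiniteAbelianGroup} {Y : ConnectionSet B} {l l′ : ℕ} (L : Listing Y l l′)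
         (c₁ c₂ : TypicalCovering B Y) where
  private
    module B = FiniteAbelianGroup B
    module C₁ = TypicalCovering c₁
    module C₂ = TypicalCovering c₂
    module A₁ = FiniteAbelianGroup C₁.A
    module A₂ = FiniteAbelianGroup C₂.A
    module L₁ = Lifts L c₁
    module L₂ = Lifts L c₂
    module f₁ = GroupMorphisms.IsGroupHomomorphism C₁.isHomomorphism
    module φ₁ = GroupMorphisms.IsGroupHomomorphism L₁.φ-hom
    module φ₂ = GroupMorphisms.IsGroupHomomorphism L₂.φ-hom

  isomorphic⇒K≐K : IsomorphicCoverings C₁.covering C₂.covering → Member L₁.K ≐ Member L₂.K
  isomorphic⇒K≐K c₁≅c₂ =
    (λ {a} → isomorphic⇒K⩽K L c₁ c₂ c₁≅c₂ {a}) ,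
    (λ {a} → isomorphic⇒K⩽K L c₂ c₁
      (IsomorphicCoverings-sym {p₁ = C₁.covering} {p₂ = C₂.covering} c₁≅c₂) {a})

  -- Each vertex of one cover is written as an integer vector and evaluated in the other. Equality
  -- of the kernels makes the outcome independent of the vector chosen.
  K≐K⇒isomorphic : Member L₁.K ≐ Member L₂.K → IsomorphicCoverings C₁.covering C₂.covering
  K≐K⇒isomorphic (K₁⩽K₂ , K₂⩽K₁) =
    record
      { bijection = record
        { to        = to
        ; from      = from
        ; to-cong   = to-cong
        ; from-cong = from-cong
        ; inverse   =
            (λ {h} {g} g≈ → A₂.trans (to-cong g≈) (to∘from h)) ,
            (λ {g} {h} h≈ → A₁.trans (from-cong h≈) (from∘to g))
        }
      ; adjacency = λ g h → mk⇔ (adj₁₂ g h) (adj₂₁ g h)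
      } ,
    λ v → B.trans (L₂.f∘φ (s₁ v)) (B.trans (B.sym (L₁.f∘φ (s₁ v))) (f₁.⟦⟧-cong (φ₁∘s₁ v)))
    where
    -- `s₁` and `s₂` are arbitrary choices of preimages, neither additive nor known to respect
    -- equality; `transfer₁₂` and `transfer₂₁` make up for this.
    s₁ : A₁.Carrier → Vector ℤ (l ℕ.+ l′)
    s₁ g = proj₁ (evaluate-surjective L₁.lifted g)
    φ₁∘s₁ : ∀ g → L₁.φ (s₁ g) A₁.≈ g
    φ₁∘s₁ g = proj₂ (evaluate-surjective L₁.lifted g)
    s₂ : A₂.Carrier → Vector ℤ (l ℕ.+ l′)
    s₂ h = proj₁ (evaluate-surjective L₂.lifted h)
    φ₂∘s₂ : ∀ h → L₂.φ (s₂ h) A₂.≈ h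
    φ₂∘s₂ h = proj₂ (evaluate-surjective L₂.lifted h)

    to : A₁.Carrier → A₂.Carrier
    to g = L₂.φ (s₁ g)
    from : A₂.Carrier → A₁.Carrier
    from h = L₁.φ (s₂ h)

    transfer₁₂ : ∀ a b → L₁.φ a A₁.≈ L₁.φ b → L₂.φ a A₂.≈ L₂.φ b
    transfer₁₂ a b e = L₂.K⇒≈ a b (K₁⩽K₂ {λ i → a i ℤ.+ ℤ.- b i} (L₁.≈⇒K a b e))
    transfer₂₁ : ∀ a b → L₂.φ a A₂.≈ L₂.φ b → L₁.φ a A₁.≈ L₁.φ b
    transfer₂₁ a b e = L₁.K⇒≈ a b (K₂⩽K₁ {λ i → a i ℤ.+ ℤ.- b i} (L₂.≈⇒K a b e))

    to-cong : ∀ {g h} → g A₁.≈ h → to g A₂.≈ to h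
    to-cong {g} {h} e = transfer₁₂ (s₁ g) (s₁ h) (A₁.trans (φ₁∘s₁ g) (A₁.trans e (A₁.sym (φ₁∘s₁ h))))
    from-cong : ∀ {g h} → g A₂.≈ h → from g A₁.≈ from h
    from-cong {g} {h} e = transfer₂₁ (s₂ g) (s₂ h) (A₂.trans (φ₂∘s₂ g) (A₂.trans e (A₂.sym (φ₂∘s₂ h))))
    to∘from : ∀ h → to (from h) A₂.≈ h
    to∘from h = A₂.trans (transfer₁₂ (s₁ (from h)) (s₂ h) (φ₁∘s₁ (from h))) (φ₂∘s₂ h)
    from∘to : ∀ g → from (to g) A₁.≈ g
    from∘to g = A₁.trans (transfer₂₁ (s₂ (to g)) (s₁ g) (φ₂∘s₂ (to g))) (φ₁∘s₁ g)

    infixl 6 _+unit_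
    _+unit_ : Vector ℤ (l ℕ.+ l′) → Index l l′ → Vector ℤ (l ℕ.+ l′)
    (a +unit k) i = a i ℤ.+ unit k i

    φ₁-step : ∀ a k → L₁.φ (a +unit k) A₁.≈ L₁.φ a A₁.∙ L₁.listed-X k
    φ₁-step a k = A₁.trans (φ₁.homo a (unit {l} {l′} k)) (A₁.∙-congˡ (evaluate-unit L₁.lifted k))
    φ₂-step : ∀ a k → L₂.φ (a +unit k) A₂.≈ L₂.φ a A₂.∙ L₂.listed-X k
    φ₂-step a k = A₂.trans (φ₂.homo a (unit {l} {l′} k)) (A₂.∙-congˡ (evaluate-unit L₂.lifted k))

    adj₁₂ : ∀ g h → Graph.Adj (Cay C₁.A C₁.X) g h → Graph.Adj (Cay C₂.A C₂.X) (to g) (to h)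
    adj₁₂ g h (x , x∈X , h≈) with k , x≈ ← proj₁ (Listing.lists L₁.lifted) x∈X =
      L₂.listed-X k , L₂.listed-X∈X k ,
      -- The chosen vector of `h` and that of `g` moved by `unit k` both evaluate to `h` in A₁,
      -- hence they agree in A₂.
      A₂.trans (transfer₁₂ (s₁ h) (s₁ g +unit k) (begin
        L₁.φ (s₁ h)                     ≈⟨ φ₁∘s₁ h ⟩
        h                               ≈⟨ h≈ ⟩
        g A₁.∙ x                        ≈⟨ A₁.∙-cong (A₁.sym (φ₁∘s₁ g)) x≈ ⟩
        L₁.φ (s₁ g) A₁.∙ L₁.listed-X k  ≈⟨ φ₁-step (s₁ g) k ⟨
        L₁.φ (s₁ g +unit k)             ∎)) (φ₂-step (s₁ g) k)
      where open SetoidReasoning A₁.setoid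
    adj₂₁ : ∀ g h → Graph.Adj (Cay C₂.A C₂.X) (to g) (to h) → Graph.Adj (Cay C₁.A C₁.X) g h
    adj₂₁ g h (x , x∈X , to-h≈) with k , x≈ ← proj₁ (Listing.lists L₂.lifted) x∈X =
      L₁.listed-X k , L₁.listed-X∈X k , (begin
        h                               ≈⟨ φ₁∘s₁ h ⟨
        L₁.φ (s₁ h)                     ≈⟨ transfer₂₁ (s₁ h) (s₁ g +unit k) (A₂.trans to-h≈
                                             (A₂.trans (A₂.∙-congˡ x≈) (A₂.sym (φ₂-step (s₁ g) k)))) ⟩
        L₁.φ (s₁ g +unit k)             ≈⟨ φ₁-step (s₁ g) k ⟩
        L₁.φ (s₁ g) A₁.∙ L₁.listed-X k  ≈⟨ A₁.∙-congʳ (φ₁∘s₁ g) ⟩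
        g A₁.∙ L₁.listed-X k            ∎)
      where open SetoidReasoning A₁.setoid

-- Realising an admissible subgroup

-- The difference is twice a unit vector of the second block. It makes the generator over y′ⱼ its
-- own negative in the quotient.
δ-symmetric-mod-R₀ : ∀ {l l′} (j : Fin l′) →
  Member (R₀ l l′) (λ i → δ (l ↑ʳ j) i ℤ.- (ℤ.- δ (l ↑ʳ j) i))
δ-symmetric-mod-R₀ {l} {l′} j =
  (λ i → ≡.cong (λ z → z ℤ.- (ℤ.- z)) (δ-↑ʳ-↑ˡ j i)) ,
  (λ i → divides (δ (l ↑ʳ j) (l ↑ʳ i)) (doubled (δ (l ↑ʳ j) (l ↑ʳ i))))
  where
  doubled : ∀ z → z ℤ.- (ℤ.- z) ≡ z ℤ.* + 2
  doubled z = begin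
    z ℤ.- (ℤ.- z)            ≡⟨ ≡.cong (λ w → z ℤ.+ w) (ℤ.neg-involutive z) ⟩
    z ℤ.+ z                  ≡⟨ ≡.cong₂ ℤ._+_ (ℤ.*-identityʳ z) (ℤ.*-identityʳ z) ⟨
    z ℤ.* + 1 ℤ.+ z ℤ.* + 1  ≡⟨ ℤ.*-distribˡ-+ z (+ 1) (+ 1) ⟨
    z ℤ.* + 2                ∎
    where open ≡.≡-Reasoning

-- The quotient to be made finite has all integer vectors as representatives; its enumeration is
-- borrowed from A⁰.
finite-via-≅ : (G : AbGroup) (A : FiniteAbelianGroup) →
  G ≅ FiniteAbelianGroup.abelianGroup A → FiniteAbelianGroup
finite-via-≅ G A G≅A = record
  { abelianGroup = G
  ; finite       = proj₁ A.finite ,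
      Compose.inverse (≅⇒Inverse {G} {A.abelianGroup} G≅A) (proj₂ A.finite)
  }
  where module A = FiniteAbelianGroup A

module Quotient {B : FiniteAbelianGroup} {Y : ConnectionSet B} {l l′ : ℕ} (L : Listing Y l l′)
                (N : Subgroup (ℤ^ (l ℕ.+ l′))) (D : Subgroup (ℤ^ (l ℕ.+ l′) / N))
                (A⁰ : FiniteAbelianGroup)
                (quotient≅A⁰ : ℤ^ (l ℕ.+ l′) / N / D ≅ FiniteAbelianGroup.abelianGroup A⁰)
                (N⩽R⟨Y⟩ : N ⩽ R⟨Y⟩ L) (D⩽R⟨Y⟩/N : D ⩽ R⟨Y⟩ L mod N)
                (R₀/N⩽D : R₀ l l′ mod N ⩽ D) where
  private
    module B = FiniteAbelianGroup B
    module L = Listing L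
    module ev = GroupMorphisms.IsGroupHomomorphism (evaluate-homomorphism L)
    G : AbGroup
    G = ℤ^ (l ℕ.+ l′)
    V : Set
    V = Vector ℤ (l ℕ.+ l′)

  A : FiniteAbelianGroup
  A = finite-via-≅ (G / N / D) A⁰ quotient≅A⁰

  private
    module A = FiniteAbelianGroup A

  -- Quotients keep the carrier, so the projection from ℤ^{l+l′} is `id`.
  representative-isHomomorphism : IsHomomorphism G A.abelianGroup id
  representative-isHomomorphism = Composition.isGroupHomomorphism {G₂ = AbelianGroup.rawGroup (G / N)}
    (λ {a} {b} {c} → A.trans {a} {b} {c}) (/-isHomomorphism {G} N) (/-isHomomorphism {G / N} D)

  -- Equality in A puts the difference in `D`, hence in R(Y) / N, and by N ⩽ R(Y) in R(Y) itself.
  f-cong : ∀ {a b} → a A.≈ b → evaluate L a B.≈ evaluate L b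
  f-cong {a} {b} e = difference∈Ker⇒≈ {G} {B.abelianGroup} (evaluate-homomorphism L) a b
    (mod-⩽ (R⟨Y⟩ L) N (R⟨Y⟩ L) N⩽R⟨Y⟩ id {λ i → a i ℤ.- b i} (D⩽R⟨Y⟩/N {λ i → a i ℤ.- b i} e))

  f-isHomomorphism : IsHomomorphism A.abelianGroup B.abelianGroup (evaluate L)
  f-isHomomorphism = mkHomomorphism A.abelianGroup B.abelianGroup (evaluate L)
    (λ {a} {b} → f-cong {a} {b}) ev.homo

  u : Index l l′ → V
  u = unit

  IsUnit : Pred V 0ℓ
  IsUnit a = ∃[ k ] a A.≈ u k

  f-unit : ∀ {a} k → a A.≈ u k → evaluate L a B.≈ L.listed k
  f-unit {a} k a≈ = B.trans (f-cong {a} {u k} a≈) (evaluate-unit L k)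

  -- For ±yᵢ the sign is built into `unit`; for y′ⱼ the difference is twice a unit vector, which
  -- lies in R₀ and so in `D`.
  u-negate : ∀ k → A._≈_ (u k A.⁻¹) (u (negate k))
  u-negate (inj₁ i)        = A.refl {u (inj₂ (inj₁ i))}
  u-negate (inj₂ (inj₁ i)) = AP.⁻¹-involutive (u (inj₁ i))
    where module AP = AbelianGroupProperties A.abelianGroup
  u-negate (inj₂ (inj₂ j)) = A.sym {u (inj₂ (inj₂ j))} {u (inj₂ (inj₂ j)) A.⁻¹}
    (R₀/N⩽D {λ i → δ (l ↑ʳ j) i ℤ.- (ℤ.- δ (l ↑ʳ j) i)}
      (⩽-mod (R₀ l l′) N {λ i → δ (l ↑ʳ j) i ℤ.- (ℤ.- δ (l ↑ʳ j) i)} (δ-symmetric-mod-R₀ {l} j)))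

  X : ConnectionSet A
  X = record
    { Elem      = IsUnit
    ; resp      = λ {a} {b} e (k , a≈) → k , A.trans {b} {a} {u k} (A.sym {a} {b} e) a≈
    ; symmetric = λ {a} (k , a≈) → negate k ,
        A.trans {a A.⁻¹} {u k A.⁻¹} {u (negate k)} (A.⁻¹-cong {a} {u k} a≈) (u-negate k)
    ; 0∉        = λ (k , 0≈) → ConnectionSet.0∉ Y (ConnectionSet.resp Y
        (B.trans (B.sym (f-unit {A.ε} k 0≈)) ev.ε-homo) (listed∈ L k))
    ; generates = λ a → ⟨⟩-map {G} {A.abelianGroup} representative-isHomomorphism
        (λ { (k , ≡.refl) → gen (k , A.refl {u k}) }) (units-generate l l′ a)
    }

  covering : TypicalCovering B Y
  covering = record
    { A              = A
    ; X              = X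
    ; f              = evaluate L
    ; isHomomorphism = f-isHomomorphism
    ; surjective     = evaluate-surjective L
    ; image          = (λ {b} (a , (k , a≈) , fa≈b) →
                          ConnectionSet.resp Y (B.trans (B.sym (f-unit {a} k a≈)) fa≈b) (listed∈ L k)) ,
                       over
    ; X∩ker          = λ {a} (k , a≈) fa≈0 → ConnectionSet.0∉ Y
                         (ConnectionSet.resp Y (B.trans (B.sym (f-unit {a} k a≈)) fa≈0) (listed∈ L k))
    ; bijective      = record
      { maps       = λ {a} (k , a≈) → ConnectionSet.resp Y (B.sym (f-unit {a} k a≈)) (listed∈ L k)
      -- Equal images give equal listed elements of Y, and distinctness of the listing makes the two
      -- indices the same.
      ; injective  = λ {a} {b} (k , a≈) (k′ , b≈) fa≈fb → A.trans {a} {u k} {b} a≈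
          (A.trans {u k} {u k′} {b}
            (A.reflexive (≡.cong u (L.distinct {k} {k′}
              (B.trans (B.sym (f-unit {a} k a≈)) (B.trans fa≈fb (f-unit {b} k′ b≈))))))
            (A.sym {b} {u k′} b≈))
      ; surjective = over
      }
    }
    where
    over : ∀ {b} → Elem Y b → ∃[ a ] (IsUnit a × evaluate L a B.≈ b)
    over b∈Y = let (k , b≈) = proj₁ L.lists b∈Y in
      u k , (k , A.refl {u k}) , B.trans (evaluate-unit L k) (B.sym b≈)

  open Lifts L covering using (φ; φ-hom; K; listed-X; listed-unique; lifted)

  -- Both sides are homomorphisms, so units suffice. The lift of `listed k` used by `φ` was
  -- extracted from surjectivity, but by uniqueness of lifts in X it is the class of `unit k`.
  φ-represents : ∀ a → φ a A.≈ a
  φ-represents = homs-agree-on-units {l} {l′} {A.abelianGroup} {φ} {id} φ-hom representative-isHomomorphism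
    (λ k → A.trans {φ (u k)} {listed-X k} {u k} (evaluate-unit lifted k)
      (A.sym {u k} {listed-X k} (listed-unique {u k} (k , A.refl {u k}) k (evaluate-unit L k))))

  -- `φ` is the projection by `φ-represents`, so its kernel consists of the vectors that vanish
  -- modulo `D`.
  K≐D : Member K ≐ Member D
  K≐D =
    (λ {a} φa≈ε → ≈ε⇒∈D {a} (A.trans {a} {φ a} {A.ε} (A.sym {φ a} {a} (φ-represents a)) φa≈ε)) ,
    (λ {a} a∈D → A.trans {φ a} {a} {A.ε} (φ-represents a) (∈D⇒≈ε {a} a∈D))
    where
    module AD = Subgroup D
    -- a A.≈ A.ε says that a - 0, rather than a, is in D.
    ε≈ : ∀ a → AbelianGroup._≈_ (G / N) (λ i → a i ℤ.- 0ℤ) a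
    ε≈ a = GroupMorphisms.IsGroupHomomorphism.⟦⟧-cong (/-isHomomorphism {G} N)
             {λ i → a i ℤ.- 0ℤ} {a} (λ i → ℤ.+-identityʳ (a i))
    ≈ε⇒∈D : ∀ {a} → a A.≈ A.ε → Member D a
    ≈ε⇒∈D {a} = AD.resp {λ i → a i ℤ.- 0ℤ} {a} (ε≈ a)
    ∈D⇒≈ε : ∀ {a} → Member D a → a A.≈ A.ε
    ∈D⇒≈ε {a} = AD.resp {a} {λ i → a i ℤ.- 0ℤ}
      (AbelianGroup.sym (G / N) {λ i → a i ℤ.- 0ℤ} {a} (ε≈ a))

  kernel≅quotient : asGroup (TypicalCovering.kernel covering) ≅
    asGroup (R⟨Y⟩ L mod N) / restrict D (R⟨Y⟩ L mod N)
  kernel≅quotient = mkIsomorphism (asGroup (TypicalCovering.kernel covering)) Q g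
    -- Equality on both sides unfolds to membership of the difference in `D`, so `id` proves
    -- congruence here and injectivity below.
    (mkHomomorphism (asGroup (TypicalCovering.kernel covering)) Q g id
      (λ (a , _) (b , _) → A.refl {λ i → a i ℤ.+ b i}))
    id
    (λ (a , a∈R̄) → (a , mod-⩽ (R⟨Y⟩ L) N (R⟨Y⟩ L) N⩽R⟨Y⟩ id {a} a∈R̄) , A.refl {a})
    where
    Q : AbGroup
    Q = asGroup (R⟨Y⟩ L mod N) / restrict D (R⟨Y⟩ L mod N)
    g : AbelianGroup.Carrier (asGroup (TypicalCovering.kernel covering)) → AbelianGroup.Carrier Q
    g (a , a∈R) = a , ⩽-mod (R⟨Y⟩ L) N {a} a∈R

-- The correspondence between classes of coverings and subgroups.

theorem2p3 : (B : FiniteAbelianGroup) (Y : ConnectionSet B)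
    (l l′ : ℕ) (L : Listing Y l l′)
    (A⁰ F : FiniteAbelianGroup) →
    Bijection (CoveringClasses B Y A⁰ F) (AdmissibleSubgroups L F A⁰)
theorem2p3 B Y l l′ L A⁰ F = record
  { to        = to
  -- The subgroup `D` of a covering has by definition the members of `K`, so statements about `K`
  -- apply unchanged.
  ; cong      = λ {(c , _)} {(d , _)} → isomorphic⇒K≐K L c d
  ; bijective =
      (λ {(c , _)} {(d , _)} → K≐K⇒isomorphic L c d) ,
      λ D → let (c , K⊆D , D⊆K) = cover D in
        -- Surjectivity is asked for every covering isomorphic to the constructed one, hence the
        -- passage through the invariance of `K`.
        c , λ {(d , _)} d≅c →
          let (K⊆K′ , K′⊆K) = isomorphic⇒K≐K L d (proj₁ c) d≅c
          in (λ {a} a∈K → K⊆D {a} (K⊆K′ {a} a∈K)) , (λ {a} a∈D → K′⊆K {a} (D⊆K {a} a∈D))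
  }
  where
  open FiniteAbelianGroup using (abelianGroup)
  to : Setoid.Carrier (CoveringClasses B Y A⁰ F) → Setoid.Carrier (AdmissibleSubgroups L F A⁰)
  to (c , A≅A⁰ , kernel≅F) =
    D {F} kernel≅F , (λ {a} → D⩽R̄⟨Y⟩ {F} kernel≅F {a}) , (λ {a} → R̄₀⩽D {F} kernel≅F {a}) ,
    ≅-trans {ℤ^ (l ℕ.+ l′) / R L F / D {F} kernel≅F} {abelianGroup (TypicalCovering.A c)} {abelianGroup A⁰}
      (quotient≅A {F} kernel≅F) A≅A⁰ ,
    ≅-trans {asGroup (R̄⟨Y⟩ L F) / restrict (D {F} kernel≅F) (R̄⟨Y⟩ L F)}
      {asGroup (TypicalCovering.kernel c)} {abelianGroup F}
      (quotient≅kernel {F} kernel≅F) kernel≅F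
    where open Lifts L c

  cover : (D : Setoid.Carrier (AdmissibleSubgroups L F A⁰)) →
    ∃[ c ] (Member (Lifts.K L (proj₁ c)) ≐ Member (proj₁ D))
  cover (D , D⩽R̄⟨Y⟩ , R̄₀⩽D , quotient≅A⁰ , quotient≅F) =
    (Q.covering , quotient≅A⁰ ,
      ≅-trans {asGroup (TypicalCovering.kernel Q.covering)}
        {asGroup (R̄⟨Y⟩ L F) / restrict D (R̄⟨Y⟩ L F)} {abelianGroup F}
        Q.kernel≅quotient quotient≅F) ,
    Q.K≐D
    where
    module Q = Quotient L (R L F) D A⁰ quotient≅A⁰ (R⩽R⟨Y⟩ L F) D⩽R̄⟨Y⟩ R̄₀⩽D
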